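{- Let $m\ge 3$ be an integer, let $D\subset\{0,1,\dots,m-1\}$ with $1<\#D<m$, and let $K_{m,D}$ be the associated missing-digit set. For a sequence $\{a_n\}_{n\ge 1}$ of positive integers, define $Q_n:=\frac{a_n}{(a_n,m^\infty)}$. Fix a prime $p_0\nmid m$, and let $t=t(m,p_0)$ and $c_{m,D}$ be as defined in the context. Suppose there exist functions $\alpha,\beta:\mathbb{N}\to\mathbb{R}$ and an index $N\in\mathbb{N}$ such that for every $n\ge N$, $$\nu_{p_0}(Q_n)\ge\alpha(n),\qquad P^+(Q_n)\le\beta(n),\qquad \beta(n)\ge 2,$$ and moreover there exists $n_0\ge N$ such that for all $n\ge n_0$, $$\alpha(n)>t+\log_{p_0}(\beta(n)-1)+\log_{p_0}(c_{m,D}).$$ Then $\frac{1}{a_n}\notin K_{m,D}$ for all $n\ge n_0$. In particular, the intersection $\left\{\frac{1}{a_n}:n\in\mathbb{N}\right\}\cap K_{m,D}$ is finite.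
   Context: $\mathbb{N}=\{1,2,3,\dots\}$. The missing-digit set is $K_{m,D}:=\left\{\sum_{j=1}^\infty \frac{b_j}{m^j}: b_j\in D\text{ for all }j\ge 1\right\}\subset[0,1]$. For a prime $p$, $\nu_p$ denotes the $p$-adic valuation. For a positive integer $A$, $(A,m^\infty):=\prod_{p\mid m}p^{\nu_p(A)}$ (product over primes $p$ dividing $m$) is the full $m$-part of $A$. $P^+(n)$ denotes the largest prime divisor of $n$, with the convention $P^+(1)=1$. For coprime integers $u,q\ge 1$, $\operatorname{ord}_q(u)$ is the multiplicative order of $u$ modulo $q$. The constant is $$c_{m,D}:=2(m-1)\min\left\{1,\frac{\#D}{m-\#D}\right\}.$$ For a prime $p_0\nmid m$, the overhead parameter is $t(m,p_0):=\nu_{p_0}\bigl(m^{\operatorname{ord}_{p_0}(m)}-1\bigr)$ if $p_0$ is odd, and $t(m,2):=\nu_2(m^2-1)-1$ if $p_0=2$. -}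

module Defs where

open import Level using (0ℓ)
open import Algebra.Bundles using (CommutativeRing)
open import Data.Bool.Base using (if_then_else_)
open import Data.Fin.Base using (Fin; toℕ)
open import Data.Fin.Properties using (nonZeroIndex)
open import Data.Fin.Subset using (Subset; _∈_; ∣_∣)
open import Data.Integer.Base as ℤ using (ℤ; +_; -[1+_])
import Data.Integer.Properties as ℤ
open import Data.List.Base using (List; map; filter; upTo)
import Data.List.Relation.Unary.All as All
import Data.List.Relation.Unary.All.Properties as All
open import Data.List.Relation.Unary.Any using (Any)
open import Data.Nat.Base as ℕ using (ℕ; zero; suc; z≤n; s≤s)
open import Data.Nat.Coprimality as Coprime using (1-coprimeTo)
open import Data.Nat.Divisibility using (_∣_; _∣?_)
open import Data.Nat.ListAction using (product)
open import Data.Nat.ListAction.Properties using (product≢0)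
open import Data.Nat.Primality using (Prime; prime?; prime⇒nonZero)
import Data.Nat.Properties as ℕ
open import Data.Product.Base using (∃; ∃₂; _×_; _,_; proj₁; proj₂)
open import Data.Rational.Base
  using (ℚ; mkℚ; toℚᵘ; _/_; _+_; _-_; -_; _*_; 1/_; _⊓_; _<_; _≤_; 0ℚ; 1ℚ; ½;
         NonNegative; positive; nonNegative; nonPositive; ↥_; ↧ₙ_)
open import Data.Rational.Properties
import Data.Rational.Unnormalised.Base as ℚᵘ
import Data.Rational.Unnormalised.Properties as ℚᵘ
open import Data.Rational.Solver using (module +-*-Solver)
open import Data.Sum.Base using (_⊎_; inj₁; inj₂; swap)
open import Relation.Binary.Definitions using (tri<; tri≈; tri>)
open import Relation.Binary.PropositionalEquality
open import Relation.Nullary using (¬_; Dec; yes; no; does; from-yes; contradiction; _×-dec_)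
open import Relation.Unary using (Pred; Decidable)

open import Algebra.Properties.Semiring.Exp
  (CommutativeRing.semiring +-*-commutativeRing)
  using (_^_; ^-assocʳ)
open import Algebra.Properties.CommutativeSemiring.Exp
  (CommutativeRing.commutativeSemiring +-*-commutativeRing)
  using (^-distrib-*)

-- Dedekind reals: located two-sided cuts; L and U collect the rationals
-- strictly below and strictly above the number.
record ℝ : Set₁ where
  field
    L U         : Pred ℚ 0ℓ
    L-inhabited : ∃ L
    U-inhabited : ∃ U
    L-lower     : ∀ {q r} → q < r → L r → L q
    L-open      : ∀ {q} → L q → ∃ λ r → q < r × L r
    U-upper     : ∀ {q r} → q < r → U q → U r
    U-open      : ∀ {r} → U r → ∃ λ q → q < r × U q
    disjoint    : ∀ {q} → L q → ¬ U q
    located     : ∀ {q r} → q < r → L q ⊎ U r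

  L<U : ∀ {q r} → L q → U r → q < r
  L<U {q} {r} l u with <-cmp q r
  ... | tri< q<r _ _    = q<r
  ... | tri≈ _ refl _   = contradiction u (disjoint l)
  ... | tri> _ _ r<q    = contradiction u (disjoint (L-lower r<q l))

  L-lower-≤ : ∀ {q r} → q ≤ r → L r → L q
  L-lower-≤ {q} {r} q≤r l with <-cmp q r
  ... | tri< q<r _ _    = L-lower q<r l
  ... | tri≈ _ refl _   = l
  ... | tri> _ _ r<q    = contradiction (<-≤-trans r<q q≤r) (<-irrefl refl)

  U-upper-≤ : ∀ {q r} → q ≤ r → U q → U r
  U-upper-≤ {q} {r} q≤r u with <-cmp q r
  ... | tri< q<r _ _    = U-upper q<r u
  ... | tri≈ _ refl _   = u
  ... | tri> _ _ r<q    = contradiction (<-≤-trans r<q q≤r) (<-irrefl refl)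

open ℝ

infix 4 _≤ℝ_ _<ℝ_ _≃_

_≤ℝ_ : ℝ → ℝ → Set
x ≤ℝ y = ∀ {q} → L x q → L y q

_<ℝ_ : ℝ → ℝ → Set
x <ℝ y = ∃ λ q → U x q × L y q

_≃_ : ℝ → ℝ → Set
x ≃ y = x ≤ℝ y × y ≤ℝ x

fromℕ : ℕ → ℚ
fromℕ n = + n / 1

0<⇒nonNeg : ∀ {p} → 0ℚ < p → NonNegative p
0<⇒nonNeg 0<p = nonNegative (<⇒≤ 0<p)

½+½ : ∀ p → ½ * p + ½ * p ≡ p
½+½ p = begin
  ½ * p + ½ * p  ≡⟨ *-distribʳ-+ p ½ ½ ⟨
  1ℚ * p         ≡⟨ *-identityˡ p ⟩
  p              ∎
  where open ≡-Reasoning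

0<½* : ∀ {p} → 0ℚ < p → 0ℚ < ½ * p
0<½* {p} 0<p = positive⁻¹ _ {{pos*pos⇒pos ½ p {{positive 0<p}}}}

p<p+q : ∀ p {q} → 0ℚ < q → p < p + q
p<p+q p 0<q = subst (_< p + _) (+-identityʳ p) (+-monoʳ-< p 0<q)

p-q<p : ∀ p {q} → 0ℚ < q → p - q < p
p-q<p p {q} 0<q =
  subst (p - q <_) (+-identityʳ p) (+-monoʳ-< p (neg-antimono-< 0<q))

0<q-p : ∀ {p q} → p < q → 0ℚ < q - p
0<q-p {p} {q} p<q = subst (_< q - p) (+-inverseʳ p) (+-monoˡ-< (- p) p<q)

private module Identities where
  open +-*-Solver

  p+[q-p]≡q : ∀ p q → p + (q - p) ≡ q
  p+[q-p]≡q = solve 2 (λ p q → p :+ (q :- p) := q) refl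

  p+q-q≡p : ∀ p q → (p + q) - q ≡ p
  p+q-q≡p = solve 2 (λ p q → (p :+ q) :- q := p) refl

  neg-involutive : ∀ p → - (- p) ≡ p
  neg-involutive = solve 1 (λ p → :- (:- p) := p) refl

  interchange : ∀ p q r s → (p + r) + (q + s) ≡ (p + q) + (r + s)
  interchange = solve 4 (λ p q r s → (p :+ r) :+ (q :+ s) := (p :+ q) :+ (r :+ s)) refl

  bernoulli-step : ∀ δ n → (1ℚ + δ) * (1ℚ + n * δ) ≡ (1ℚ + (1ℚ + n) * δ) + n * (δ * δ)
  bernoulli-step = solve 2
    (λ δ n → (con 1ℚ :+ δ) :* (con 1ℚ :+ n :* δ)
          := (con 1ℚ :+ (con 1ℚ :+ n) :* δ) :+ n :* (δ :* δ)) refl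

  p-p*q : ∀ p q → p - p * q ≡ p * (1ℚ + - q)
  p-p*q = solve 2 (λ p q → p :- p :* q := p :* (con 1ℚ :+ :- q)) refl

  p+p≡2p : ∀ p → p + p ≡ (1ℚ + 1ℚ) * p
  p+p≡2p = solve 1 (λ p → p :+ p := (con 1ℚ :+ con 1ℚ) :* p) refl

open Identities

neg-swap-< : ∀ {p q} → - p < q → - q < p
neg-swap-< {p} {q} lt = subst (- q <_) (neg-involutive p) (neg-antimono-< lt)

neg-swap-<′ : ∀ {p q} → p < - q → q < - p
neg-swap-<′ {p} {q} lt = subst (_< - p) (neg-involutive q) (neg-antimono-< lt)

fromℕ-suc : ∀ n → fromℕ (suc n) ≡ 1ℚ + fromℕ n
fromℕ-suc n with fromℕ n | ↥p/↧p≡p (mkℚ (+ n) 0 (Coprime.sym (1-coprimeTo n)))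
... | _ | refl = /-cong (cong (ℤ._+_ (+ 1)) (sym (ℤ.*-identityʳ (+ n)))) refl

fromℕ-nonNeg : ∀ n → 0ℚ ≤ fromℕ n
fromℕ-nonNeg n = nonNegative⁻¹ (fromℕ n) {{normalize-nonNeg n 1}}

fromℕ-pos : ∀ n → 0ℚ < fromℕ (suc n)
fromℕ-pos n = positive⁻¹ (fromℕ (suc n)) {{normalize-pos (suc n) 1}}

<fromℕ : ∀ q → ∃ λ n → q < fromℕ n
<fromℕ q@(mkℚ i d-1 _) = suc ℤ.∣ i ∣ ,
  toℚᵘ-cancel-< (ℚᵘ.<-respʳ-≃ (ℚᵘ.≃-sym (toℚᵘ-fromℚᵘ (ℚᵘ.mkℚᵘ (+ suc ℤ.∣ i ∣) 0)))
    (ℚᵘ.*<* (ℤ.≤-<-trans step₁ (ℤ.<-≤-trans step₂ step₃))))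
  where
  step₁ : i ℤ.* + 1 ℤ.≤ + ℤ.∣ i ∣
  step₁ = subst (ℤ._≤ + ℤ.∣ i ∣) (sym (ℤ.*-identityʳ i)) (i≤∣i∣ i)
    where
    i≤∣i∣ : ∀ i → i ℤ.≤ + ℤ.∣ i ∣
    i≤∣i∣ (+ n)    = ℤ.≤-refl
    i≤∣i∣ -[1+ n ] = ℤ.-≤+
  step₂ : + ℤ.∣ i ∣ ℤ.< + suc ℤ.∣ i ∣
  step₂ = ℤ.+<+ ℕ.≤-refl
  step₃ : + suc ℤ.∣ i ∣ ℤ.≤ + suc ℤ.∣ i ∣ ℤ.* + suc d-1
  step₃ = subst (+ suc ℤ.∣ i ∣ ℤ.≤_) (ℤ.pos-* (suc ℤ.∣ i ∣) (suc d-1))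
            (ℤ.+≤+ (ℕ.m≤m*n (suc ℤ.∣ i ∣) (suc d-1)))

archimedean : ∀ p q {δ} → 0ℚ < δ → ∃ λ n → q < p + fromℕ n * δ
archimedean p q {δ} 0<δ = n , (begin-strict
  q                          ≡⟨ p+[q-p]≡q p q ⟨
  p + (q - p)                ≡⟨ cong (_+_ p) cancel ⟨
  p + ((q - p) * 1/δ) * δ    <⟨ +-monoʳ-< p (*-monoˡ-<-pos δ {{positive 0<δ}} (proj₂ bound)) ⟩
  p + fromℕ n * δ            ∎)
  where
  open ≤-Reasoning
  instance
    _ = positive 0<δ
    _ = pos⇒nonZero δ
  1/δ = 1/ δ
  bound = <fromℕ ((q - p) * 1/δ)
  n = proj₁ bound
  cancel : ((q - p) * 1/δ) * δ ≡ q - p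
  cancel = trans (*-assoc (q - p) 1/δ δ)
             (trans (cong (_*_ (q - p)) (*-inverseˡ δ)) (*-identityʳ (q - p)))

-- Any x lies in an interval (r , r + ε) with rational end points.
approximate : ∀ x {ε} → 0ℚ < ε → ∃ λ r → L x r × U x (r + ε)
approximate x {ε} 0<ε =
  let (p , p∈L) = L-inhabited x
      (q , q∈U) = U-inhabited x
      (n , q<)  = archimedean p q 0<δ
  in walk n p p∈L (U-upper x q< q∈U)
  where
  δ = ½ * ε
  0<δ = 0<½* 0<ε
  walk : ∀ n p → L x p → U x (p + fromℕ n * δ) → ∃ λ r → L x r × U x (r + ε)
  walk zero p p∈L u =
    contradiction (subst (U x) (trans (cong (_+_ p) (*-zeroˡ δ)) (+-identityʳ p)) u)
                  (disjoint x p∈L)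
  walk (suc n) p p∈L u with located x (p<p+q (p + δ) 0<δ)
  ... | inj₁ p+δ∈L = walk n (p + δ) p+δ∈L (subst (U x) shift u)
    where
    open ≡-Reasoning
    shift : p + fromℕ (suc n) * δ ≡ (p + δ) + fromℕ n * δ
    shift = begin
      p + fromℕ (suc n) * δ            ≡⟨ cong (λ k → p + k * δ) (fromℕ-suc n) ⟩
      p + (1ℚ + fromℕ n) * δ           ≡⟨ cong (_+_ p) (*-distribʳ-+ δ 1ℚ (fromℕ n)) ⟩
      p + (1ℚ * δ + fromℕ n * δ)       ≡⟨ cong (λ z → p + (z + fromℕ n * δ)) (*-identityˡ δ) ⟩
      p + (δ + fromℕ n * δ)            ≡⟨ +-assoc p δ (fromℕ n * δ) ⟨
      (p + δ) + fromℕ n * δ            ∎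
  ... | inj₂ u′ = p , p∈L , subst (U x) (trans (+-assoc p δ δ) (cong (_+_ p) (½+½ ε))) u′

fromℚ : ℚ → ℝ
fromℚ p = record
  { L           = λ q → q < p
  ; U           = λ q → p < q
  ; L-inhabited = p - 1ℚ , p-q<p p (positive⁻¹ 1ℚ)
  ; U-inhabited = p + 1ℚ , p<p+q p (positive⁻¹ 1ℚ)
  ; L-lower     = <-trans
  ; L-open      = λ q<p → let (r , q<r , r<p) = <-dense q<p in r , q<r , r<p
  ; U-upper     = λ q<r p<q → <-trans p<q q<r
  ; U-open      = λ p<r → let (q , p<q , q<r) = <-dense p<r in q , q<r , p<q
  ; disjoint    = <-asym
  ; located     = λ {q} {r} q<r → loc q<r
  }
  where
  loc : ∀ {q r} → q < r → q < p ⊎ p < r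
  loc {q} q<r with q <? p
  ... | yes q<p = inj₁ q<p
  ... | no  q≮p = inj₂ (≤-<-trans (≮⇒≥ q≮p) q<r)

infix  8 -ℝ_
infixl 6 _+ℝ_ _-ℝ_

-ℝ_ : ℝ → ℝ
-ℝ x = record
  { L           = λ q → U x (- q)
  ; U           = λ q → L x (- q)
  ; L-inhabited = let (q , u) = U-inhabited x in - q , subst (U x) (sym (neg-involutive q)) u
  ; U-inhabited = let (q , l) = L-inhabited x in - q , subst (L x) (sym (neg-involutive q)) l
  ; L-lower     = λ q<r → U-upper x (neg-antimono-< q<r)
  ; L-open      = λ u → let (r , r< , u′) = U-open x u
                        in - r , neg-swap-<′ r< , subst (U x) (sym (neg-involutive r)) u′
  ; U-upper     = λ q<r → L-lower x (neg-antimono-< q<r)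
  ; U-open      = λ l → let (r , <r , l′) = L-open x l
                        in - r , neg-swap-< <r , subst (L x) (sym (neg-involutive r)) l′
  ; disjoint    = λ u l → disjoint x l u
  ; located     = λ q<r → swap (located x (neg-antimono-< q<r))
  }

_+ℝ_ : ℝ → ℝ → ℝ
x +ℝ y = record
  { L           = λ q → ∃₂ λ r s → L x r × L y s × q ≡ r + s
  ; U           = λ q → ∃₂ λ r s → U x r × U y s × q ≡ r + s
  ; L-inhabited = let (r , l) = L-inhabited x ; (s , l′) = L-inhabited y
                  in r + s , r , s , l , l′ , refl
  ; U-inhabited = let (r , u) = U-inhabited x ; (s , u′) = U-inhabited y
                  in r + s , r , s , u , u′ , refl
  ; L-lower     = λ { q<q′ (r , s , l , l′ , refl) → lower q<q′ l l′ }
  ; L-open      = λ { (r , s , l , l′ , refl) →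
                    let (r′ , r<r′ , l″) = L-open x l
                    in r′ + s , +-monoˡ-< s r<r′ , r′ , s , l″ , l′ , refl }
  ; U-upper     = λ { q<q′ (r , s , u , u′ , refl) → upper (<⇒≤ q<q′) u u′ }
  ; U-open      = λ { (r , s , u , u′ , refl) →
                    let (r′ , r′<r , u″) = U-open x u
                    in r′ + s , +-monoˡ-< s r′<r , r′ , s , u″ , u′ , refl }
  ; disjoint    = λ { (r , s , l , l′ , refl) (r′ , s′ , u , u′ , eq) →
                    <-irrefl eq (+-mono-< (L<U x l u) (L<U y l′ u′)) }
  ; located     = loc
  }
  where
  lower : ∀ {q r s} → q < r + s → L x r → L y s → ∃₂ λ r s → L x r × L y s × q ≡ r + s
  lower {q} {r} {s} q<r+s l l′ =
    r , q - r
    , l , L-lower y (subst (q - r <_) r+s-r≡s (+-monoˡ-< (- r) q<r+s)) l′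
    , sym (p+[q-p]≡q r q)
    where
    r+s-r≡s : (r + s) - r ≡ s
    r+s-r≡s = trans (cong (_- r) (+-comm r s)) (p+q-q≡p s r)
  upper : ∀ {q r s} → r + s ≤ q → U x r → U y s → ∃₂ λ r s → U x r × U y s × q ≡ r + s
  upper {q} {r} {s} r+s≤q u u′ =
    r , q - r
    , u , U-upper-≤ y (subst (_≤ q - r) r+s-r≡s (+-monoˡ-≤ (- r) r+s≤q)) u′
    , sym (p+[q-p]≡q r q)
    where
    r+s-r≡s : (r + s) - r ≡ s
    r+s-r≡s = trans (cong (_- r) (+-comm r s)) (p+q-q≡p s r)
  loc : ∀ {q q′} → q < q′ → (∃₂ λ r s → L x r × L y s × q ≡ r + s)
                          ⊎ (∃₂ λ r s → U x r × U y s × q′ ≡ r + s)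
  loc {q} {q′} q<q′ = decide (approximate x 0<δ) (approximate y 0<δ)
    where
    δ = ½ * (q′ - q)
    0<δ : 0ℚ < δ
    0<δ = 0<½* (0<q-p q<q′)
    decide : (∃ λ r → L x r × U x (r + δ)) → (∃ λ s → L y s × U y (s + δ)) → _
    decide (r , l , u) (s , l′ , u′) = split (q <? r + s)
      where
      bound : ¬ (q < r + s) → (r + δ) + (s + δ) ≤ q′
      bound q≮r+s = begin
        (r + δ) + (s + δ)  ≡⟨ interchange r s δ δ ⟩
        (r + s) + (δ + δ)  ≡⟨ cong (_+_ (r + s)) (½+½ (q′ - q)) ⟩
        (r + s) + (q′ - q) ≤⟨ +-monoˡ-≤ (q′ - q) (≮⇒≥ q≮r+s) ⟩
        q + (q′ - q)       ≡⟨ p+[q-p]≡q q q′ ⟩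
        q′                 ∎
        where open ≤-Reasoning
      split : Dec (q < r + s) → _
      split (yes q<r+s) = inj₁ (lower q<r+s l l′)
      split (no  q≮r+s) = inj₂ (upper (bound q≮r+s) u u′)

_-ℝ_ : ℝ → ℝ → ℝ
x -ℝ y = x +ℝ (-ℝ y)

natℝ : ℕ → ℝ
natℝ n = fromℚ (fromℕ n)

^-pos : ∀ {p} → 0ℚ < p → ∀ n → 0ℚ < p ^ n
^-pos 0<p zero    = positive⁻¹ 1ℚ
^-pos {p} 0<p (suc n) =
  positive⁻¹ _ {{pos*pos⇒pos p {{positive 0<p}} (p ^ n) {{positive (^-pos 0<p n)}}}}

^-mono-≤ : ∀ {p q} → 0ℚ < p → p ≤ q → ∀ n → p ^ n ≤ q ^ n
^-mono-≤ 0<p p≤q zero = ≤-refl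
^-mono-≤ {p} {q} 0<p p≤q (suc n) = ≤-trans
  (*-monoʳ-≤-nonNeg (p ^ n) {{0<⇒nonNeg (^-pos 0<p n)}} p≤q)
  (*-monoˡ-≤-nonNeg q {{0<⇒nonNeg (<-≤-trans 0<p p≤q)}} (^-mono-≤ 0<p p≤q n))

^-mono-< : ∀ {p q} → 0ℚ < p → p < q → ∀ n → p ^ suc n < q ^ suc n
^-mono-< {p} {q} 0<p p<q n = <-≤-trans
  (*-monoˡ-<-pos (p ^ n) {{positive (^-pos 0<p n)}} p<q)
  (*-monoˡ-≤-nonNeg q {{0<⇒nonNeg (<-trans 0<p p<q)}}
    (^-mono-≤ 0<p (<⇒≤ p<q) n))

^-cancel-< : ∀ {p q} → 0ℚ < q → ∀ n → p ^ n < q ^ n → p < q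
^-cancel-< {p} {q} 0<q n lt with p <? q
... | yes p<q = p<q
... | no  p≮q = contradiction (<-≤-trans lt (^-mono-≤ 0<q (≮⇒≥ p≮q) n)) (<-irrefl refl)

1^n≡1 : ∀ n → 1ℚ ^ n ≡ 1ℚ
1^n≡1 zero    = refl
1^n≡1 (suc n) = trans (*-identityˡ (1ℚ ^ n)) (1^n≡1 n)

^-one : ∀ p → p ^ 1 ≡ p
^-one = *-identityʳ

0≤p*p : ∀ p → 0ℚ ≤ p * p
0≤p*p p with ≤-total 0ℚ p
... | inj₁ 0≤p = nonNegative⁻¹ _
  {{nonNeg*nonNeg⇒nonNeg p {{nonNegative 0≤p}} p {{nonNegative 0≤p}}}}
... | inj₂ p≤0 = nonNegative⁻¹ _
  {{nonPos*nonPos⇒nonPos p {{nonPositive p≤0}} p {{nonPositive p≤0}}}}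

bernoulli : ∀ {δ} → 0ℚ ≤ 1ℚ + δ → ∀ n → 1ℚ + fromℕ n * δ ≤ (1ℚ + δ) ^ n
bernoulli {δ} 0≤1+δ zero = ≤-reflexive (cong (_+_ 1ℚ) (*-zeroˡ δ))
bernoulli {δ} 0≤1+δ (suc n) = begin
  1ℚ + fromℕ (suc n) * δ                              ≡⟨ cong (λ k → 1ℚ + k * δ) (fromℕ-suc n) ⟩
  1ℚ + (1ℚ + fromℕ n) * δ                             ≡⟨ +-identityʳ _ ⟨
  (1ℚ + (1ℚ + fromℕ n) * δ) + 0ℚ                      ≤⟨ +-monoʳ-≤ (1ℚ + (1ℚ + fromℕ n) * δ) nonneg ⟩
  (1ℚ + (1ℚ + fromℕ n) * δ) + fromℕ n * (δ * δ)       ≡⟨ bernoulli-step δ (fromℕ n) ⟨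
  (1ℚ + δ) * (1ℚ + fromℕ n * δ)                       ≤⟨ *-monoˡ-≤-nonNeg (1ℚ + δ) {{nonNegative 0≤1+δ}} (bernoulli 0≤1+δ n) ⟩
  (1ℚ + δ) * (1ℚ + δ) ^ n                             ∎
  where
  open ≤-Reasoning
  nonneg : 0ℚ ≤ fromℕ n * (δ * δ)
  nonneg = nonNegative⁻¹ _ {{nonNeg*nonNeg⇒nonNeg
    (fromℕ n) {{nonNegative (fromℕ-nonNeg n)}} (δ * δ) {{nonNegative (0≤p*p δ)}}}}

^-archimedean : ∀ {p q} c → 0ℚ < p → p < q → ∃ λ k → p ^ suc k * c < q ^ suc k
^-archimedean {p} {q} c 0<p p<q = k , (begin-strict
  p ^ suc k * c                          <⟨ *-monoʳ-<-pos (p ^ suc k) {{positive (^-pos 0<p (suc k))}} c< ⟩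
  p ^ suc k * (1ℚ + fromℕ (suc k) * δ)   ≤⟨ *-monoˡ-≤-nonNeg (p ^ suc k) {{0<⇒nonNeg (^-pos 0<p (suc k))}} (bernoulli (<⇒≤ 0<1+δ) (suc k)) ⟩
  p ^ suc k * (1ℚ + δ) ^ suc k           ≡⟨ ^-distrib-* p (1ℚ + δ) (suc k) ⟨
  (p * (1ℚ + δ)) ^ suc k                 ≡⟨ cong (_^ suc k) q≡ ⟨
  q ^ suc k                              ∎)
  where
  open ≤-Reasoning
  instance
    _ = positive 0<p
    _ = pos⇒nonZero p
  δ = (q - p) * 1/ p
  0<δ : 0ℚ < δ
  0<δ = positive⁻¹ δ
    {{pos*pos⇒pos (q - p) {{positive (0<q-p p<q)}} (1/ p) {{1/pos⇒pos p}}}}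
  0<1+δ : 0ℚ < 1ℚ + δ
  0<1+δ = <-trans (positive⁻¹ 1ℚ) (p<p+q 1ℚ 0<δ)
  k = proj₁ (archimedean 1ℚ c 0<δ)
  c< : c < 1ℚ + fromℕ (suc k) * δ
  c< = <-trans (proj₂ (archimedean 1ℚ c 0<δ))
         (subst (1ℚ + fromℕ k * δ <_)
           (sym (trans (cong (λ z → 1ℚ + z * δ) (fromℕ-suc k))
                (trans (cong (_+_ 1ℚ) (*-distribʳ-+ δ 1ℚ (fromℕ k)))
                (trans (cong (λ z → 1ℚ + (z + fromℕ k * δ)) (*-identityˡ δ))
                (trans (cong (_+_ 1ℚ) (+-comm δ (fromℕ k * δ)))
                       (sym (+-assoc 1ℚ (fromℕ k * δ) δ)))))))
           (p<p+q (1ℚ + fromℕ k * δ) 0<δ))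
  q≡ : q ≡ p * (1ℚ + δ)
  q≡ = begin-equality
    q                              ≡⟨ p+[q-p]≡q p q ⟨
    p + (q - p)                    ≡⟨ cong (_+_ p) (*-identityˡ (q - p)) ⟨
    p + 1ℚ * (q - p)               ≡⟨ cong (λ z → p + z * (q - p)) (*-inverseʳ p) ⟨
    p + (p * 1/ p) * (q - p)       ≡⟨ cong (_+_ p) (*-assoc p (1/ p) (q - p)) ⟩
    p + p * (1/ p * (q - p))       ≡⟨ cong (λ z → p + p * z) (*-comm (1/ p) (q - p)) ⟩
    p + p * δ                      ≡⟨ cong (_+ p * δ) (*-identityʳ p) ⟨
    p * 1ℚ + p * δ                 ≡⟨ *-distribˡ-+ p 1ℚ δ ⟨
    p * (1ℚ + δ)                   ∎

infixr 8 _^ℤ_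

_^ℤ_ : (b : ℕ) .{{_ : ℕ.NonZero b}} → ℤ → ℚ
b ^ℤ (+ k)    = fromℕ b ^ k
b ^ℤ -[1+ k ] = (+ 1 / b) ^ suc k

/-cross : ∀ i d .{{_ : ℕ.NonZero d}} → ↥ (i / d) ℤ.* + d ≡ i ℤ.* + ↧ₙ (i / d)
/-cross i (suc d) = cross (i / suc d) (toℚᵘ-fromℚᵘ (ℚᵘ.mkℚᵘ i d))
  where
  cross : ∀ q → toℚᵘ q ℚᵘ.≃ ℚᵘ.mkℚᵘ i d → ↥ q ℤ.* + suc d ≡ i ℤ.* + ↧ₙ q
  cross (mkℚ _ _ _) (ℚᵘ.*≡* eq) = eq

</-cross : ∀ q i d .{{_ : ℕ.NonZero d}} → ↥ q ℤ.* + d ℤ.< i ℤ.* + ↧ₙ q → q < i / d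
</-cross q@(mkℚ _ _ _) i (suc d) lt =
  toℚᵘ-cancel-< (ℚᵘ.<-respʳ-≃ (ℚᵘ.≃-sym (toℚᵘ-fromℚᵘ (ℚᵘ.mkℚᵘ i d))) (ℚᵘ.*<* lt))

/<-cross : ∀ q i d .{{_ : ℕ.NonZero d}} → i ℤ.* + ↧ₙ q ℤ.< ↥ q ℤ.* + d → i / d < q
/<-cross q@(mkℚ _ _ _) i (suc d) lt =
  toℚᵘ-cancel-< (ℚᵘ.<-respˡ-≃ (ℚᵘ.≃-sym (toℚᵘ-fromℚᵘ (ℚᵘ.mkℚᵘ i d))) (ℚᵘ.*<* lt))

fromℕ-mono-< : ∀ {m n} → m ℕ.< n → fromℕ m < fromℕ n
fromℕ-mono-< {m} {n} m<n = </-cross (fromℕ m) (+ n) 1 (ℤ.*-cancelʳ-<-nonNeg (+ 1) lt)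
  where
  lt : ↥ (fromℕ m) ℤ.* + 1 ℤ.* + 1 ℤ.< + n ℤ.* + ↧ₙ (fromℕ m) ℤ.* + 1
  lt = subst₂ ℤ._<_ (trans (sym (/-cross (+ m) 1)) (sym (ℤ.*-identityʳ _))) (sym (ℤ.*-identityʳ _))
         (ℤ.*-monoʳ-<-pos (+ ↧ₙ (fromℕ m)) {{↧-pos (fromℕ m)}} (ℤ.+<+ m<n))
    where
    ↧-pos : ∀ q → ℤ.Positive (+ ↧ₙ q)
    ↧-pos (mkℚ _ _ _) = _

fromℕ-mono-≤ : ∀ {m n} → m ℕ.≤ n → fromℕ m ≤ fromℕ n
fromℕ-mono-≤ m≤n with ℕ.m≤n⇒m<n∨m≡n m≤n
... | inj₁ m<n  = <⇒≤ (fromℕ-mono-< m<n)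
... | inj₂ refl = ≤-refl

fromℕ*1/≡1 : ∀ n .{{_ : ℕ.NonZero n}} → fromℕ n * (+ 1 / n) ≡ 1ℚ
fromℕ*1/≡1 (suc n) = toℚᵘ-injective
  (ℚᵘ.≃-trans (toℚᵘ-homo-* (fromℕ (suc n)) (+ 1 / suc n))
  (ℚᵘ.≃-trans (ℚᵘ.*-cong (toℚᵘ-fromℚᵘ (ℚᵘ.mkℚᵘ (+ suc n) 0)) (toℚᵘ-fromℚᵘ (ℚᵘ.mkℚᵘ (+ 1) n)))
  (ℚᵘ.*≡* (trans (ℤ.*-identityʳ (+ suc n ℤ.* + 1)) (trans (ℤ.*-identityʳ (+ suc n))
    (trans (cong +_ (sym (ℕ.+-identityʳ (suc n)))) (sym (ℤ.*-identityˡ (+ (suc n ℕ.+ 0))))))))))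

^-mono-<′ : ∀ {p q} n .{{_ : ℕ.NonZero n}} → 0ℚ < p → p < q → p ^ n < q ^ n
^-mono-<′ (suc n) 0<p p<q = ^-mono-< 0<p p<q n

half-power : ∀ e .{{_ : ℕ.NonZero e}} → ∃ λ θ →
  0ℚ < θ × 0ℚ < 1ℚ + - θ × ½ ≤ (1ℚ + - θ) ^ e
half-power e = θ , 0<θ , 0<1-θ , subst (_≤ (1ℚ + - θ) ^ e)
    (cong (_+_ 1ℚ) (trans (sym (neg-distribʳ-* (fromℕ e) θ)) (cong -_ eθ≡½)))
    (bernoulli (<⇒≤ 0<1-θ) e)
  where
  θ = ½ * (+ 1 / e)
  0<θ : 0ℚ < θ
  0<θ = 0<½* (positive⁻¹ (+ 1 / e) {{normalize-pos 1 e}})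
  eθ≡½ : fromℕ e * θ ≡ ½
  eθ≡½ = trans (sym (*-assoc (fromℕ e) ½ (+ 1 / e)))
    (trans (cong (_* (+ 1 / e)) (*-comm (fromℕ e) ½))
    (trans (*-assoc ½ (fromℕ e) (+ 1 / e))
    (cong (_*_ ½) (fromℕ*1/≡1 e))))
  θ≤½ : θ ≤ ½
  θ≤½ = subst₂ _≤_ (*-identityˡ θ) eθ≡½
    (*-monoʳ-≤-nonNeg θ {{0<⇒nonNeg 0<θ}} (fromℕ-mono-≤ (ℕ.>-nonZero⁻¹ e)))
  0<1-θ : 0ℚ < 1ℚ + - θ
  0<1-θ = <-≤-trans (positive⁻¹ ½) (+-monoʳ-≤ 1ℚ (neg-antimono-≤ θ≤½))

-- x^e > a or x^e < a′, decided on a rational interval (r , s) around x that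
-- is narrow enough for s^e ≤ 2 r^e.
separate : ∀ x {p₀} → 0ℚ < p₀ → L x p₀ → ∀ e .{{_ : ℕ.NonZero e}} {a a′} → a + a ≤ a′ →
           (∃ λ r → 0ℚ < r × L x r × a < r ^ e) ⊎ (∃ λ s → U x s × s ^ e < a′)
separate x {p₀} 0<p₀ p₀∈L e {a} {a′} 2a≤a′ = pick (half-power e)
  where
  Goal = (∃ λ r → 0ℚ < r × L x r × a < r ^ e) ⊎ (∃ λ s → U x s × s ^ e < a′)

  pick : (∃ λ θ → 0ℚ < θ × 0ℚ < 1ℚ + - θ × ½ ≤ (1ℚ + - θ) ^ e) → Goal
  pick (θ , 0<θ , 0<1-θ , ½≤) =
    narrow (approximate x (positive⁻¹ _ {{pos*pos⇒pos θ {{positive 0<θ}} p₀ {{positive 0<p₀}}}}))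
    where
    narrow : (∃ λ r → L x r × U x (r + θ * p₀)) → Goal
    narrow (r , r∈L , s∈U) = decide (a <? r ^ e)
      where
      s = r + θ * p₀

      0<s : 0ℚ < s
      0<s = <-trans 0<p₀ (L<U x p₀∈L s∈U)

      s[1-θ]<r : s * (1ℚ + - θ) < r
      s[1-θ]<r = begin-strict
        s * (1ℚ + - θ)   ≡⟨ p-p*q s θ ⟨
        s - s * θ        ≡⟨ cong (λ z → s - z) (*-comm s θ) ⟩
        s - θ * s        <⟨ +-monoʳ-< s (neg-antimono-< (*-monoʳ-<-pos θ {{positive 0<θ}} (L<U x p₀∈L s∈U))) ⟩
        s - θ * p₀       ≡⟨ p+q-q≡p r (θ * p₀) ⟩
        r                ∎
        where open ≤-Reasoning

      0<s[1-θ] : 0ℚ < s * (1ℚ + - θ)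
      0<s[1-θ] = positive⁻¹ _
        {{pos*pos⇒pos s {{positive 0<s}} (1ℚ + - θ) {{positive 0<1-θ}}}}

      s^e/2≤r^e : s ^ e * ½ ≤ r ^ e
      s^e/2≤r^e = begin
        s ^ e * ½                  ≤⟨ *-monoˡ-≤-nonNeg (s ^ e) {{0<⇒nonNeg (^-pos 0<s e)}} ½≤ ⟩
        s ^ e * (1ℚ + - θ) ^ e     ≡⟨ ^-distrib-* s (1ℚ + - θ) e ⟨
        (s * (1ℚ + - θ)) ^ e       ≤⟨ ^-mono-≤ 0<s[1-θ] (<⇒≤ s[1-θ]<r) e ⟩
        r ^ e                      ∎
        where open ≤-Reasoning

      shrink : r ^ e ≤ a → (∃ λ s′ → s′ < s × U x s′) → ∃ λ s → U x s × s ^ e < a′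
      shrink r^e≤a (s′ , s′<s , s′∈U) = s′ , s′∈U , (begin-strict
        s′ ^ e                  <⟨ ^-mono-<′ e (<-trans 0<p₀ (L<U x p₀∈L s′∈U)) s′<s ⟩
        s ^ e                   ≡⟨ ½+½ (s ^ e) ⟨
        ½ * s ^ e + ½ * s ^ e   ≡⟨ cong₂ _+_ (*-comm ½ (s ^ e)) (*-comm ½ (s ^ e)) ⟩
        s ^ e * ½ + s ^ e * ½   ≤⟨ +-mono-≤ s^e/2≤a s^e/2≤a ⟩
        a + a                   ≤⟨ 2a≤a′ ⟩
        a′                      ∎)
        where
        open ≤-Reasoning
        s^e/2≤a : s ^ e * ½ ≤ a
        s^e/2≤a = ≤-trans s^e/2≤r^e r^e≤a

      decide : Dec (a < r ^ e) → Goal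
      decide (yes a<r^e) = inj₁ (r , <-trans 0<s[1-θ] s[1-θ]<r , r∈L , a<r^e)
      decide (no  a≮r^e) = inj₂ (shrink (≮⇒≥ a≮r^e) (U-open x s∈U))

module _ (b : ℕ) .{{b>1 : ℕ.NonTrivial b}} where

  private
    instance
      b≢0 : ℕ.NonZero b
      b≢0 = ℕ.nonTrivial⇒nonZero b

    B = fromℕ b

  1<B : 1ℚ < B
  1<B = fromℕ-mono-< (ℕ.nonTrivial⇒n>1 b)

  0<B : 0ℚ < B
  0<B = <-trans (positive⁻¹ 1ℚ) 1<B

  B*1/B≡1 : B * (+ 1 / b) ≡ 1ℚ
  B*1/B≡1 = fromℕ*1/≡1 b

  0<1/B : 0ℚ < + 1 / b
  0<1/B = positive⁻¹ (+ 1 / b) {{normalize-pos 1 b}}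

  1/B<1 : + 1 / b < 1ℚ
  1/B<1 = subst₂ _<_ (*-identityˡ (+ 1 / b)) B*1/B≡1
            (*-monoˡ-<-pos (+ 1 / b) {{positive 0<1/B}} 1<B)

  ^ℤ-pos : ∀ i → 0ℚ < b ^ℤ i
  ^ℤ-pos (+ k)    = ^-pos 0<B k
  ^ℤ-pos -[1+ k ] = ^-pos 0<1/B (suc k)

  ^ℤ-suc : ∀ i → b ^ℤ (ℤ.suc i) ≡ B * b ^ℤ i
  ^ℤ-suc (+ k)          = refl
  ^ℤ-suc -[1+ zero ]    = sym (trans (cong (_*_ B) (^-one (+ 1 / b))) B*1/B≡1)
  ^ℤ-suc -[1+ suc k ]   = sym (trans (sym (*-assoc B (+ 1 / b) _))
                            (trans (cong (_* (+ 1 / b) ^ suc k) B*1/B≡1) (*-identityˡ _)))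

  ^ℤ-+ : ∀ k i → b ^ℤ (+ k ℤ.+ i) ≡ B ^ k * b ^ℤ i
  ^ℤ-+ zero i = trans (cong (b ^ℤ_) (ℤ.+-identityˡ i)) (sym (*-identityˡ _))
  ^ℤ-+ (suc k) i =
    trans (cong (b ^ℤ_) (ℤ.+-assoc (+ 1) (+ k) i))
    (trans (^ℤ-suc (+ k ℤ.+ i))
    (trans (cong (_*_ B) (^ℤ-+ k i)) (sym (*-assoc B (B ^ k) (b ^ℤ i)))))

  ^ℤ-* : ∀ i k → (b ^ℤ i) ^ k ≡ b ^ℤ (i ℤ.* + k)
  ^ℤ-* (+ n) k =
    trans (^-assocʳ B n k) (cong (b ^ℤ_) (ℤ.pos-* n k))
  ^ℤ-* -[1+ n ] zero = cong (b ^ℤ_) (sym (ℤ.*-zeroʳ -[1+ n ]))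
  ^ℤ-* -[1+ n ] (suc k) = ^-assocʳ (+ 1 / b) (suc n) (suc k)

  B^n≥1 : ∀ n → 1ℚ ≤ B ^ n
  B^n≥1 n = subst (_≤ B ^ n) (1^n≡1 n) (^-mono-≤ (positive⁻¹ 1ℚ) (<⇒≤ 1<B) n)

  ≤⇒diff : ∀ {i j} → i ℤ.≤ j → ∃ λ k → j ≡ + k ℤ.+ i
  ≤⇒diff {i} {j} i≤j with j ℤ.- i in eq | ℤ.i≤j⇒0≤j-i i≤j
  ... | + k | _ = k , trans (sym (ℤ.+-identityʳ j))
    (trans (cong (ℤ._+_ j) (sym (ℤ.+-inverseˡ i)))
    (trans (sym (ℤ.+-assoc j (ℤ.- i) i)) (cong (ℤ._+ i) eq)))

  ^ℤ-mono-≤ : ∀ {i j} → i ℤ.≤ j → b ^ℤ i ≤ b ^ℤ j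
  ^ℤ-mono-≤ {i} {j} i≤j with ≤⇒diff i≤j
  ... | k , refl = subst₂ _≤_ (*-identityˡ _) (sym (^ℤ-+ k i))
    (*-monoʳ-≤-nonNeg (b ^ℤ i) {{0<⇒nonNeg (^ℤ-pos i)}} (B^n≥1 k))

  B*^ℤ≤ : ∀ {i j} → i ℤ.< j → B * b ^ℤ i ≤ b ^ℤ j
  B*^ℤ≤ {i} {j} i<j = subst (_≤ b ^ℤ j) (^ℤ-suc i) (^ℤ-mono-≤ (ℤ.i<j⇒suc[i]≤j i<j))

  -- If j/e ≤ i/d, then b^(i/d) < r implies b^(j/e) < r.
  below-mono : ∀ i j {r} d e .{{_ : ℕ.NonZero d}} .{{_ : ℕ.NonZero e}} → 0ℚ < r → j ℤ.* + d ℤ.≤ i ℤ.* + e →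
               b ^ℤ i < r ^ d → b ^ℤ j < r ^ e
  below-mono i j {r} d e@(suc e-1) 0<r jd≤ie lt =
    ^-cancel-< (^-pos 0<r e) d (begin-strict
      (b ^ℤ j) ^ d        ≡⟨ ^ℤ-* j d ⟩
      b ^ℤ (j ℤ.* + d)    ≤⟨ ^ℤ-mono-≤ jd≤ie ⟩
      b ^ℤ (i ℤ.* + e)    ≡⟨ ^ℤ-* i e ⟨
      (b ^ℤ i) ^ e        <⟨ ^-mono-< (^ℤ-pos i) lt e-1 ⟩
      (r ^ d) ^ e         ≡⟨ ^-assocʳ r d e ⟩
      r ^ (d ℕ.* e)       ≡⟨ cong (r ^_) (ℕ.*-comm d e) ⟩
      r ^ (e ℕ.* d)       ≡⟨ ^-assocʳ r e d ⟨
      (r ^ e) ^ d         ∎)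
    where open ≤-Reasoning

  above-mono : ∀ i j {r} d e .{{_ : ℕ.NonZero d}} .{{_ : ℕ.NonZero e}} → 0ℚ < r → i ℤ.* + e ℤ.≤ j ℤ.* + d →
               r ^ d < b ^ℤ i → r ^ e < b ^ℤ j
  above-mono i j {r} d e@(suc e-1) 0<r ie≤jd lt =
    ^-cancel-< (^ℤ-pos j) d (begin-strict
      (r ^ e) ^ d         ≡⟨ ^-assocʳ r e d ⟩
      r ^ (e ℕ.* d)       ≡⟨ cong (r ^_) (ℕ.*-comm d e) ⟨
      r ^ (d ℕ.* e)       ≡⟨ ^-assocʳ r d e ⟨
      (r ^ d) ^ e         <⟨ ^-mono-< (^-pos 0<r d) lt e-1 ⟩
      (b ^ℤ i) ^ e        ≡⟨ ^ℤ-* i e ⟩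
      b ^ℤ (i ℤ.* + e)    ≤⟨ ^ℤ-mono-≤ ie≤jd ⟩
      b ^ℤ (j ℤ.* + d)    ≡⟨ ^ℤ-* j d ⟨
      (b ^ℤ j) ^ d        ∎)
    where open ≤-Reasoning

  -- The base-b logarithm of x > 0.  For q = i/d, q < log_b x means b^i < x^d.
  log : (x : ℝ) → natℝ 0 <ℝ x → ℝ
  log x (p₀ , 0<p₀ , p₀∈L) = record
    { L           = Lower
    ; U           = Upper
    ; L-inhabited =
        let (k , lt) = ^-archimedean (1/ p₀) 0<1/B 1/B<1
        in -[1+ k ] / 1 , p₀ , 0<p₀ , p₀∈L
           , below-mono -[1+ k ] (↥ (-[1+ k ] / 1)) 1 (↧ₙ (-[1+ k ] / 1)) {{_}} {{↧-nz (-[1+ k ] / 1)}} 0<p₀ (ℤ.≤-reflexive (/-cross -[1+ k ] 1))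
               (subst (b ^ℤ -[1+ k ] <_) (sym (^-one p₀))
                 (cancel-1/p₀ (subst ((+ 1 / b) ^ suc k * 1/ p₀ <_) (1^n≡1 (suc k)) lt)))
    ; U-inhabited =
        let (s , s∈U) = U-inhabited x
            (k , lt)  = ^-archimedean s (positive⁻¹ 1ℚ) 1<B
        in + suc k / 1 , s , s∈U
           , above-mono (+ suc k) (↥ (+ suc k / 1)) 1 (↧ₙ (+ suc k / 1)) {{_}} {{↧-nz (+ suc k / 1)}} (0<U s∈U) (ℤ.≤-reflexive (sym (/-cross (+ suc k) 1)))
               (subst₂ _<_ (trans (cong (_* s) (1^n≡1 (suc k))) (trans (*-identityˡ s) (sym (^-one s)))) refl lt)
    ; L-lower     = λ { {q} {q′} q<q′ (r , 0<r , l , lt) →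
        r , 0<r , l , below-mono (↥ q′) (↥ q) (↧ₙ q′) (↧ₙ q) {{↧-nz q′}} {{↧-nz q}} 0<r (<⇒cross q<q′) lt }
    ; L-open      = λ { {q} (r , 0<r , l , lt) → L-step q r 0<r l lt }
    ; U-upper     = λ { {q} {q′} q<q′ (s , u , lt) →
        s , u , above-mono (↥ q) (↥ q′) (↧ₙ q) (↧ₙ q′) {{↧-nz q}} {{↧-nz q′}} (0<U u) (<⇒cross q<q′) lt }
    ; U-open      = λ { {q} (s , u , lt) → U-step q s u lt }
    ; disjoint    = λ { {q} (r , 0<r , l , lt) (s , u , lt′) →
        <-asym (<-trans lt′ lt) (^-mono-<′ (↧ₙ q) {{↧-nz q}} 0<r (L<U x l u)) }
    ; located     = loc
    }
    where
    -- The conditions b^(↥ q) < x^(↧ q) and x^(↧ q) < b^(↥ q), tested on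
    -- rationals below and above x.
    Lower Upper : Pred ℚ 0ℓ
    Lower q = ∃ λ r → 0ℚ < r × L x r × b ^ℤ (↥ q) < r ^ ↧ₙ q
    Upper q = ∃ λ s → U x s × s ^ ↧ₙ q < b ^ℤ (↥ q)

    instance
      _ = positive 0<p₀
      _ = pos⇒nonZero p₀

    ↧-nz : ∀ q → ℕ.NonZero (↧ₙ q)
    ↧-nz (mkℚ _ _ _) = _

    0<U : ∀ {s} → U x s → 0ℚ < s
    0<U u = <-trans 0<p₀ (L<U x p₀∈L u)

    <⇒cross : ∀ {q q′} → q < q′ → ↥ q ℤ.* + ↧ₙ q′ ℤ.≤ ↥ q′ ℤ.* + ↧ₙ q
    <⇒cross {mkℚ _ _ _} {mkℚ _ _ _} lt = ℤ.<⇒≤ (drop-*<* lt)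

    cancel-1/p₀ : ∀ {z} → z * 1/ p₀ < 1ℚ → z < p₀
    cancel-1/p₀ {z} lt = subst₂ _<_
      (trans (*-assoc z (1/ p₀) p₀) (trans (cong (_*_ z) (*-inverseˡ p₀)) (*-identityʳ z)))
      (*-identityˡ p₀) (*-monoˡ-<-pos p₀ lt)

    -- For q = i/d and large k, the rationals (ik ± 1)/(dk) near q lie on the
    -- same side of log_b x as q (here k is suc k).
    module Step (q : ℚ) (k : ℕ) where
      i = ↥ q
      d = ↧ₙ q
      instance
        _ = ↧-nz q
        dk≢0 : ℕ.NonZero (d ℕ.* suc k)
        dk≢0 = ℕ.m*n≢0 d (suc k)
      e = d ℕ.* suc k

      ik*d≡i*e : i ℤ.* + suc k ℤ.* + d ≡ i ℤ.* + e
      ik*d≡i*e = trans (ℤ.*-assoc i (+ suc k) (+ d))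
        (cong (i ℤ.*_) (trans (sym (ℤ.pos-* (suc k) d)) (cong +_ (ℕ.*-comm (suc k) d))))

      d>0 : ℤ.Positive (+ d)
      d>0 = ℤ.positive (ℤ.+<+ (ℕ.>-nonZero⁻¹ d))

      up = ℤ.suc (i ℤ.* + suc k)
      ik<up : i ℤ.* + suc k ℤ.< up
      ik<up = ℤ.suc[i]≤j⇒i<j ℤ.≤-refl
      q<up/e : q < up / e
      q<up/e = </-cross q up e (subst (ℤ._< up ℤ.* + d) ik*d≡i*e
        (ℤ.*-monoʳ-<-pos (+ d) {{d>0}} ik<up))

      down = ℤ.pred (i ℤ.* + suc k)
      down<ik : down ℤ.< i ℤ.* + suc k
      down<ik = ℤ.i≤pred[j]⇒i<j ℤ.≤-refl
      down/e<q : down / e < q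
      down/e<q = /<-cross q down e (subst (down ℤ.* + d ℤ.<_) ik*d≡i*e
        (ℤ.*-monoʳ-<-pos (+ d) {{d>0}} down<ik))

    L-step : ∀ q r → 0ℚ < r → L x r → b ^ℤ (↥ q) < r ^ ↧ₙ q → ∃ λ q′ → q < q′ × Lower q′
    L-step q r 0<r l lt = up / e , q<up/e , r , 0<r , l
      , below-mono up (↥ (up / e)) e (↧ₙ (up / e)) {{_}} {{↧-nz (up / e)}} 0<r
          (ℤ.≤-reflexive (/-cross up e)) (begin-strict
            b ^ℤ up                    ≡⟨ ^ℤ-suc (i ℤ.* + suc k) ⟩
            B * b ^ℤ (i ℤ.* + suc k)   ≡⟨ *-comm B _ ⟩
            b ^ℤ (i ℤ.* + suc k) * B   ≡⟨ cong (_* B) (^ℤ-* i (suc k)) ⟨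
            (b ^ℤ i) ^ suc k * B       <⟨ proj₂ large ⟩
            (r ^ d) ^ suc k            ≡⟨ ^-assocʳ r d (suc k) ⟩
            r ^ e                      ∎)
      where
      open ≤-Reasoning
      large = ^-archimedean B (^ℤ-pos (↥ q)) lt
      k = proj₁ large
      open Step q k

    U-step : ∀ q s → U x s → s ^ ↧ₙ q < b ^ℤ (↥ q) → ∃ λ q′ → q′ < q × Upper q′
    U-step q s u lt = down / e , down/e<q , s , u
      , above-mono down (↥ (down / e)) e (↧ₙ (down / e)) {{_}} {{↧-nz (down / e)}} (0<U u)
          (ℤ.≤-reflexive (sym (/-cross down e)))
          (*-cancelʳ-<-nonNeg B {{0<⇒nonNeg 0<B}} (begin-strict
            s ^ e * B                  ≡⟨ cong (_* B) (^-assocʳ s d (suc k)) ⟨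
            (s ^ d) ^ suc k * B        <⟨ proj₂ large ⟩
            (b ^ℤ i) ^ suc k           ≡⟨ ^ℤ-* i (suc k) ⟩
            b ^ℤ (i ℤ.* + suc k)       ≡⟨ cong (b ^ℤ_) (ℤ.suc-pred (i ℤ.* + suc k)) ⟨
            b ^ℤ (ℤ.suc down)          ≡⟨ ^ℤ-suc down ⟩
            B * b ^ℤ down              ≡⟨ *-comm B _ ⟩
            b ^ℤ down * B              ∎))
      where
      open ≤-Reasoning
      large = ^-archimedean B (^-pos (0<U u) (↧ₙ q)) lt
      k = proj₁ large
      open Step q k

    loc : ∀ {q q′} → q < q′ → Lower q ⊎ Upper q′
    loc {q} {q′} q<q′ = decide (separate x 0<p₀ p₀∈L e 2b^N≤b^N′)
      where
      d  = ↧ₙ q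
      d′ = ↧ₙ q′
      e  = d ℕ.* d′
      instance
        _ = ↧-nz q
        _ = ↧-nz q′
        e≢0 : ℕ.NonZero e
        e≢0 = ℕ.m*n≢0 d d′
      N  = ↥ q ℤ.* + d′
      N′ = ↥ q′ ℤ.* + d

      <⇒cross-< : ∀ {q q′} → q < q′ → ↥ q ℤ.* + ↧ₙ q′ ℤ.< ↥ q′ ℤ.* + ↧ₙ q
      <⇒cross-< {mkℚ _ _ _} {mkℚ _ _ _} = drop-*<*

      2b^N≤b^N′ : b ^ℤ N + b ^ℤ N ≤ b ^ℤ N′
      2b^N≤b^N′ = begin
        b ^ℤ N + b ^ℤ N      ≡⟨ p+p≡2p (b ^ℤ N) ⟩
        fromℕ 2 * b ^ℤ N     ≤⟨ *-monoʳ-≤-nonNeg (b ^ℤ N) {{0<⇒nonNeg (^ℤ-pos N)}}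
                                  (fromℕ-mono-≤ (ℕ.nonTrivial⇒n>1 b)) ⟩
        B * b ^ℤ N           ≤⟨ B*^ℤ≤ (<⇒cross-< q<q′) ⟩
        b ^ℤ N′              ∎
        where open ≤-Reasoning

      cross : ↥ q ℤ.* + e ≡ N ℤ.* + d
      cross = trans (cong (ℤ._*_ (↥ q)) (trans (cong +_ (ℕ.*-comm d d′)) (ℤ.pos-* d′ d)))
                    (sym (ℤ.*-assoc (↥ q) (+ d′) (+ d)))

      cross′ : N′ ℤ.* + d′ ≡ ↥ q′ ℤ.* + e
      cross′ = trans (ℤ.*-assoc (↥ q′) (+ d) (+ d′)) (cong (ℤ._*_ (↥ q′)) (sym (ℤ.pos-* d d′)))

      decide : (∃ λ r → 0ℚ < r × L x r × b ^ℤ N < r ^ e) ⊎ (∃ λ s → U x s × s ^ e < b ^ℤ N′) →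
               Lower q ⊎ Upper q′
      decide (inj₁ (r , 0<r , l , lt)) =
        inj₁ (r , 0<r , l , below-mono N (↥ q) e d 0<r (ℤ.≤-reflexive cross) lt)
      decide (inj₂ (s , u , lt)) =
        inj₂ (s , u , above-mono N′ (↥ q′) e d′ (0<U u) (ℤ.≤-reflexive cross′) lt)

record ℕ⁺ : Set where
  constructor mkℕ⁺
  field
    value         : ℕ
    .{{nonZero⁺}} : ℕ.NonZero value

open ℕ⁺ public using (value)

infix 4 _≤⁺_

_≤⁺_ : ℕ⁺ → ℕ⁺ → Set
m ≤⁺ n = value m ℕ.≤ value n

≤⁺-trans : ∀ {k m n} → k ≤⁺ m → m ≤⁺ n → k ≤⁺ n
≤⁺-trans = ℕ.≤-trans

-- The greatest k ≤ bound satisfying P, or the default if there is none.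
greatest : ∀ {P : Pred ℕ 0ℓ} → Decidable P → (default bound : ℕ) → ℕ
greatest P? default zero    = if does (P? 0) then 0 else default
greatest P? default (suc n) =
  if does (P? (suc n)) then suc n else greatest P? default n

-- The least k ∈ {start, …, start + fuel ∸ 1} satisfying P, or start + fuel
-- if there is none.
least : ∀ {P : Pred ℕ 0ℓ} → Decidable P → (start fuel : ℕ) → ℕ
least P? start zero       = start
least P? start (suc fuel) =
  if does (P? start) then start else least P? (suc start) fuel

-- The greatest k with p^k ∣ n, for p ≥ 2 and n ≥ 1; since k < p^k ≤ n the
-- search up to n loses nothing.
ν : ℕ → ℕ → ℕ
ν p n = greatest (λ k → p ℕ.^ k ∣? n) 0 n

primeDivisor? : ∀ n → Decidable (λ p → Prime p × p ∣ n)
primeDivisor? n p = prime? p ×-dec (p ∣? n)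

-- For n = 1 the search fails and returns the conventional value 1.
P⁺ : ℕ → ℕ
P⁺ n = greatest (primeDivisor? n) 1 n

-- For coprime q, u ≥ 1 the order is at most q, so the search succeeds.
ord : (q u : ℕ) → ℕ
ord q u = least (λ k → q ∣? (u ℕ.^ k ℕ.∸ 1)) 1 q

primeDivisors : ℕ → List ℕ
primeDivisors m = filter (primeDivisor? m) (upTo (suc m))

-- The full m-part (A , m^∞) of A.
mPart : (m A : ℕ) → ℕ
mPart m A = product (map (λ p → p ℕ.^ ν p A) (primeDivisors m))

mPart≢0 : ∀ m A → ℕ.NonZero (mPart m A)
mPart≢0 m A = product≢0 (All.map⁺ (All.map
  (λ { {p} (pr , _) → ℕ.m^n≢0 p (ν p A) {{prime⇒nonZero pr}} })
  (All.all-filter (primeDivisor? m) (upTo (suc m)))))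

-- A / (A , m^∞); the m-part divides A, so the division is exact.
primeToPart : (m A : ℕ) → ℕ
primeToPart m A = (A ℕ./ mPart m A) {{mPart≢0 m A}}

-- t(m , p₀); the truncated subtractions are genuine for m ≥ 3 and p₀ ∤ m.
overhead : (m p₀ : ℕ) → ℕ
overhead m p₀ =
  if does (p₀ ℕ.≟ 2) then ν 2 (m ℕ.^ 2 ℕ.∸ 1) ℕ.∸ 1
                     else ν p₀ (m ℕ.^ ord p₀ m ℕ.∸ 1)

-- c_{m,D} = 2 (m - 1) min {1 , #D / (m - #D)}.
gapConstant : (m : ℕ) (D : Subset m) → .(∣ D ∣ ℕ.< m) → ℚ
gapConstant m D #D<m =
  fromℕ (2 ℕ.* (m ℕ.∸ 1)) * (1ℚ ⊓ (+ ∣ D ∣ / (m ℕ.∸ ∣ D ∣)) {{ℕ.>-nonZero (ℕ.m<n⇒0<n∸m #D<m)}})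

infix 4 _⟶_

-- |sₙ - x| < ε for all sufficiently large n, for every rational ε > 0.
_⟶_ : (ℕ → ℚ) → ℝ → Set
s ⟶ x = ∀ ε → 0ℚ < ε → ∃ λ N → ∀ n → N ℕ.≤ n →
  fromℚ (s n - ε) <ℝ x × x <ℝ fromℚ (s n + ε)

partialSum : (ℕ → ℚ) → ℕ → ℚ
partialSum f zero    = 0ℚ
partialSum f (suc n) = partialSum f n + f n

-- b j is the digit with index j + 1, so it contributes b j / m^(j+1).
digitTerm : ∀ {m} → (ℕ → Fin m) → ℕ → ℚ
digitTerm {m} b j =
  (+ toℕ (b j) / m ℕ.^ suc j) {{ℕ.m^n≢0 m (suc j) {{nonZeroIndex (b j)}}}}

K : (m : ℕ) → Subset m → Pred ℝ 0ℓ
K m D x = ∃ λ (b : ℕ → Fin m) → (∀ j → b j ∈ D) × partialSum (digitTerm b) ⟶ x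

reciprocal : ℕ⁺ → ℝ
reciprocal a = fromℚ (+ 1 / value a)

reciprocals : (ℕ⁺ → ℕ⁺) → Pred ℝ 0ℓ
reciprocals a x = ∃ λ n → x ≃ reciprocal (a n)

-- Contained in a finite list, up to equality of reals; classically the same
-- as being finite.
Finite : Pred ℝ 0ℓ → Set₁
Finite P = ∃ λ (xs : List ℝ) → ∀ {x} → P x → Any (x ≃_) xs

2≤x⇒0<x-1 : ∀ x → natℝ 2 ≤ℝ x → natℝ 0 <ℝ x -ℝ natℝ 1
2≤x⇒0<x-1 x 2≤x = ½ , positive⁻¹ ½
  , + 7 / 4 , - (+ 5 / 4) , 2≤x (from-yes (+ 7 / 4 <? fromℕ 2)) , from-yes (1ℚ <? + 5 / 4) , refl

pos⊓pos : ∀ {p q} → 0ℚ < p → 0ℚ < q → 0ℚ < p ⊓ q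
pos⊓pos {p} {q} 0<p 0<q with ⊓-sel p q
... | inj₁ eq = subst (0ℚ <_) (sym eq) 0<p
... | inj₂ eq = subst (0ℚ <_) (sym eq) 0<q

gapConstant-pos : ∀ {m} (D : Subset m) → 1 ℕ.< ∣ D ∣ → (#D<m : ∣ D ∣ ℕ.< m) →
                  natℝ 0 <ℝ fromℚ (gapConstant m D #D<m)
gapConstant-pos {m} D 1<#D #D<m = <-dense 0<c
  where
  ratio = (+ ∣ D ∣ / (m ℕ.∸ ∣ D ∣)) {{ℕ.>-nonZero (ℕ.m<n⇒0<n∸m #D<m)}}
  0<ratio : 0ℚ < ratio
  0<ratio = positive⁻¹ ratio {{normalize-pos ∣ D ∣ (m ℕ.∸ ∣ D ∣)
    {{ℕ.>-nonZero (ℕ.m<n⇒0<n∸m #D<m)}} {{ℕ.>-nonZero (ℕ.<-trans (s≤s z≤n) 1<#D)}}}}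
  0<min : 0ℚ < 1ℚ ⊓ ratio
  0<min = pos⊓pos (positive⁻¹ 1ℚ) 0<ratio
  0<2[m-1] : 0 ℕ.< 2 ℕ.* (m ℕ.∸ 1)
  0<2[m-1] = ℕ.*-mono-≤ (s≤s (z≤n {1})) (ℕ.m<n⇒0<n∸m (ℕ.<-trans 1<#D #D<m))
  0<c : 0ℚ < gapConstant m D #D<m
  0<c = positive⁻¹ _ {{pos*pos⇒pos (fromℕ (2 ℕ.* (m ℕ.∸ 1))) {{positive (fromℕ-mono-< 0<2[m-1])}}
    (1ℚ ⊓ ratio) {{positive 0<min}}}}

{-# OPTIONS --safe #-}

-- Write p for p₀, Q for the part of a prime to m, and v = ν p Q.  If 1 / a
-- lies in K, its digits from some position on are ⌊ m r_i / Q ⌋ with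
-- r_i = u m^i mod Q and p ∤ u, and they all belong to D.
--
-- Every prime q ∣ Q has m^(q-1) ≡ 1 (mod q).  Collecting these orders, some
-- m^H is 1 modulo the part Q′ of Q prime to p, and the power of p in H
-- beyond the order of m modulo p is at most P⁺ Q - 1.  By lifting the
-- exponent, p^s ∥ m^H - 1 with p^s ≤ 2 p^t (P⁺ Q - 1), the factor 2 being
-- needed only for p = 2.  The residues r_(H j) are then all congruent modulo
-- M = p^s Q′ and distinct for j < p^(v-s), so that they fill a whole class
-- modulo M: they are p^(v-s) equally spaced points of [0 , Q).  Counting
-- them in the cells of length Q / m belonging to D gives p^(v-s) ≤ #D.
-- Since 2 #D ≤ c, this contradicts p^v > p^t (β - 1) c.

module Submission where

open import Algebra.Bundles using (CommutativeRing)
import Algebra.Properties.CommutativeSemigroup as CommutativeSemigroupProperties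
import Algebra.Properties.CommutativeSemiring.Binomial as Binomial
open import Algebra.Properties.Monoid.Sum using (sum-init-last)
open import Data.Bool.Base using (if_then_else_)
open import Data.Fin.Base as Fin using (Fin; toℕ)
import Data.Fin.Properties as Fin
open import Data.Fin.Subset as Subset using (Subset; ⊤)
import Data.Fin.Subset.Properties as Subset
open import Data.Integer.Base as ℤ using (-[1+_])
import Data.Integer.Properties as ℤ
open import Data.List.Base using ([]; _∷_; map; upTo)
open import Data.List.Membership.Propositional using (_∈_; lose)
open import Data.List.Membership.Propositional.Properties using (∈-filter⁺; ∈-map⁺; ∈-upTo⁺)
open import Data.List.Relation.Unary.All as All using (All; []; _∷_)
import Data.List.Relation.Unary.All.Properties as All
open import Data.List.Relation.Unary.Any using (Any; here; there)
import Data.List.Relation.Unary.Any.Properties as Any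
open import Data.List.Relation.Unary.Unique.Propositional using (Unique; []; _∷_)
import Data.List.Relation.Unary.Unique.Propositional.Properties as Unique
open import Data.Nat.Base
open import Data.Nat.Combinatorics using (_C_; nCk+nC[k+1]≡[n+1]C[k+1]; nC1≡n; nCn≡1; k![n∸k]!∣n!)
open import Data.Nat.Combinatorics.Specification using (nCk≡n!/k![n-k]!)
open import Data.Nat.Divisibility
open import Data.Nat.DivMod
open import Data.Nat.ListAction using (product)
open import Data.Nat.ListAction.Properties using (∈⇒∣product)
open import Data.Nat.Primality
open import Data.Nat.Primality.Factorisation using (factorise)
open import Data.Nat.Properties
open import Data.Nat.Tactic.RingSolver using (solve-∀)
open import Data.Product.Base using (∃; ∃₂; _×_; _,_; proj₁; proj₂)
open import Data.Rational.Base as ℚ using (ℚ; 0ℚ; 1ℚ; ↥_; ↧ₙ_)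
import Data.Rational.Properties as ℚ
open import Data.Rational.Solver using (module +-*-Solver)
import Data.Rational.Unnormalised.Base as ℚᵘ
import Data.Rational.Unnormalised.Properties as ℚᵘ
open import Data.Sum.Base using (_⊎_; inj₁; inj₂; [_,_]′)
open import Function.Base using (_∘_)
open import Function.Definitions using (Injective)
open import Level using (0ℓ)
open import Relation.Binary.Definitions using (tri<; tri≈; tri>)
open import Relation.Binary.PropositionalEquality
open import Relation.Nullary using (¬_; yes; no; contradiction)
open import Relation.Nullary.Decidable using (dec-false)
open import Relation.Unary using (Pred; Decidable; _∉_; _∩_)

open import Algebra.Properties.Semiring.Sum +-*-semiring using (sum)
import Algebra.Properties.Semiring.Exp +-*-semiring as Exp
import Algebra.Properties.Semiring.Mult +-*-semiring as Mult
open import Algebra.Properties.Semiring.Exp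
  (CommutativeRing.semiring ℚ.+-*-commutativeRing) using () renaming (_^_ to _^ℚ_)
open Binomial +-*-commutativeSemiring using (binomialTerm)
  renaming (theorem to binomialTheorem)

open import Defs

private
  variable
    m n p q : ℕ

-- Fermat's little theorem and lifting the exponent

-- The quadratic coefficient stays explicit because lifting by `p` depends on how `p` divides
-- `y * (p C 2)`; all higher terms go into `k`.
binomial₃ : ∀ y n → ∃ λ k → suc y ^ n ≡ 1 + y * (n + y * (n C 2 + y * k))
binomial₃ y zero    = 0 , sym (cong suc (trans (cong (y *_) (trans (cong (y *_) (*-zeroʳ y)) (*-zeroʳ y))) (*-zeroʳ y)))
binomial₃ y (suc n) with k , eq ← binomial₃ y n = n C 2 + k + y * k , (begin
  suc y * suc y ^ n                                       ≡⟨ cong (suc y *_) eq ⟩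
  suc y * (1 + y * (n + y * (n C 2 + y * k)))             ≡⟨ identity y n (n C 2) k ⟩
  1 + y * (suc n + y * (n + n C 2 + y * (n C 2 + k + y * k)))
    ≡⟨ cong (λ c → 1 + y * (suc n + y * (c + y * (n C 2 + k + y * k)))) pascal ⟩
  1 + y * (suc n + y * (suc n C 2 + y * (n C 2 + k + y * k))) ∎)
  where
  open ≡-Reasoning
  identity : ∀ y n c k → suc y * (1 + y * (n + y * (c + y * k)))
           ≡ 1 + y * (suc n + y * (n + c + y * (c + k + y * k)))
  identity = solve-∀
  pascal : n + n C 2 ≡ suc n C 2
  pascal = trans (cong (_+ n C 2) (sym (nC1≡n n))) (nCk+nC[k+1]≡[n+1]C[k+1] n 1)

binomial₂ : ∀ y n → ∃ λ k → suc y ^ n ∸ 1 ≡ y * (n + y * k)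
binomial₂ y n with k , eq ← binomial₃ y n = n C 2 + y * k , cong (_∸ 1) eq

x∸1∣x^n∸1 : ∀ x n → x ∸ 1 ∣ x ^ n ∸ 1
-- For `x = 0` truncated subtraction turns both sides into 0.
x∸1∣x^n∸1 zero    zero    = ∣-refl
x∸1∣x^n∸1 zero    (suc n) = ∣-refl
x∸1∣x^n∸1 (suc y) n with k , eq ← binomial₂ y n = subst (y ∣_) (sym eq) (m∣m*n (n + y * k))

x^m∸1∣x^n∸1 : ∀ x → m ∣ n → x ^ m ∸ 1 ∣ x ^ n ∸ 1
x^m∸1∣x^n∸1 {m} x (divides k refl) =
  subst (λ z → x ^ m ∸ 1 ∣ z ∸ 1) (trans (^-*-assoc x m k) (cong (x ^_) (*-comm m k)))
    (x∸1∣x^n∸1 (x ^ m) k)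

p∤1 : Prime p → p ∤ 1
p∤1 pr p∣1 = contradiction (∣1⇒≡1 p∣1) (nonTrivial⇒≢1 {{prime⇒nonTrivial pr}})

∤! : Prime p → ∀ j → j < p → p ∤ j !
∤! pr zero    _   p∣1  = p∤1 pr p∣1
∤! pr (suc j) j<p p∣j! with euclidsLemma (suc j) (j !) pr p∣j!
... | inj₁ p∣1+j = <⇒≱ j<p (∣⇒≤ p∣1+j)
... | inj₂ p∣j!′ = ∤! pr j (<-trans (n<1+n j) j<p) p∣j!′

-- In `(p C k) * (k ! * (p ∸ k) !) ≡ p !` the prime `p` divides the right side but neither factorial
-- on the left.
p∣pCk : Prime p → ∀ {k} → 0 < k → k < p → p ∣ p C k
p∣pCk {p@(suc p-1)} pr {k} 0<k k<p with euclidsLemma (p C k) (k ! * (p ∸ k) !) pr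
    (subst (p ∣_) (sym equation) (m∣m*n (p-1 !)))
  where
  instance _ = k !* (p ∸ k) !≢0
  equation : (p C k) * (k ! * (p ∸ k) !) ≡ p !
  equation = trans (cong (_* (k ! * (p ∸ k) !)) (nCk≡n!/k![n-k]! (<⇒≤ k<p)))
                   (m/n*n≡m (k![n∸k]!∣n! (<⇒≤ k<p)))
... | inj₁ p∣C = p∣C
... | inj₂ p∣! with euclidsLemma (k !) ((p ∸ k) !) pr p∣!
...   | inj₁ p∣k!     = contradiction p∣k! (∤! pr k k<p)
...   | inj₂ p∣[p-k]! = contradiction p∣[p-k]! (∤! pr (p ∸ k) (∸-monoʳ-< 0<k (<⇒≤ k<p)))

-- The semiring binomial theorem has its own multiples and powers; this and the next lemma turn them
-- into those of `ℕ`.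
Mult-×≡* : ∀ n x → n Mult.× x ≡ n * x
Mult-×≡* zero    x = refl
Mult-×≡* (suc n) x = cong (x +_) (Mult-×≡* n x)

Exp-^≡^ : ∀ x n → x Exp.^ n ≡ x ^ n
Exp-^≡^ x zero    = refl
Exp-^≡^ x (suc n) = cong (x *_) (Exp-^≡^ x n)

∣-sum : ∀ {d n} (t : Fin n → ℕ) → (∀ i → d ∣ t i) → d ∣ sum t
∣-sum {n = zero}  t d∣t = _ ∣0
∣-sum {n = suc n} t d∣t = ∣m∣n⇒∣m+n (d∣t Fin.zero) (∣-sum (t ∘ Fin.suc) (d∣t ∘ Fin.suc))

freshmans-dream : Prime p → ∀ a → ∃ λ k → suc a ^ p ≡ 1 + a ^ p + p * k
freshmans-dream {zero}        pr = contradiction pr ¬prime[0]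
freshmans-dream {p@(suc p-1)} pr a with ∣-sum middle p∣middle
  where
  -- The terms with index from 1 to `p-1`; modulo `p` only the two end terms survive.
  middle : Fin p-1 → ℕ
  middle i = binomialTerm a 1 p (Fin.suc (Fin.inject₁ i))
  p∣middle : ∀ i → p ∣ middle i
  p∣middle i = subst (p ∣_) (sym (Mult-×≡* (p C j) _)) (∣m⇒∣m*n _
    (p∣pCk pr z<s (s<s (subst (_< p-1) (sym (Fin.toℕ-inject₁ i)) (Fin.toℕ<n i)))))
    where j = suc (toℕ (Fin.inject₁ i))
... | divides k eq = k , (begin
  suc a ^ p                                   ≡⟨ cong (_^ p) (+-comm 1 a) ⟩
  (a + 1) ^ p                                 ≡⟨ Exp-^≡^ (a + 1) p ⟨
  (a + 1) Exp.^ p                             ≡⟨ binomialTheorem p a 1 ⟩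
  first + sum (term ∘ Fin.suc)                ≡⟨ cong (first +_) (sum-init-last +-0-monoid (term ∘ Fin.suc)) ⟩
  first + (sum (term ∘ Fin.suc ∘ Fin.inject₁) + last)
    ≡⟨ cong₂ (λ u v → u + (v + last)) first≡1 (trans eq (*-comm k p)) ⟩
  1 + (p * k + last)                          ≡⟨ cong (1 +_) (+-comm (p * k) last) ⟩
  1 + (last + p * k)                          ≡⟨ cong (λ z → 1 + (z + p * k)) last≡a^p ⟩
  1 + a ^ p + p * k                           ∎)
  where
  open ≡-Reasoning
  term = binomialTerm a 1 p
  first = term Fin.zero
  last = term (Fin.suc (Fin.fromℕ p-1))
  first≡1 : first ≡ 1
  first≡1 = trans (Mult-×≡* (p C 0) (1 * 1 Exp.^ p)) (trans (*-identityˡ _)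
    (trans (*-identityˡ _) (trans (Exp-^≡^ 1 p) (^-zeroˡ p))))
  last≡a^p : last ≡ a ^ p
  last≡a^p rewrite Fin.toℕ-fromℕ p-1 | nCn≡1 p | n∸n≡0 p-1 =
    trans (+-identityʳ _) (trans (*-identityʳ _) (Exp-^≡^ a p))

a^p≡a+pk : Prime p → ∀ a → ∃ λ k → a ^ p ≡ a + p * k
a^p≡a+pk {zero}  pr a = contradiction pr ¬prime[0]
a^p≡a+pk {suc p} pr zero = 0 , sym (*-zeroʳ p)
a^p≡a+pk {p@(suc _)} pr (suc a) with freshmans-dream pr a | a^p≡a+pk pr a
... | k , eq | k′ , eq′ = k′ + k , (begin
  suc a ^ p                    ≡⟨ eq ⟩
  1 + a ^ p + p * k            ≡⟨ cong (λ z → 1 + z + p * k) eq′ ⟩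
  1 + (a + p * k′) + p * k     ≡⟨ cong suc (+-assoc a (p * k′) (p * k)) ⟩
  suc a + (p * k′ + p * k)     ≡⟨ cong (suc a +_) (*-distribˡ-+ p k′ k) ⟨
  suc a + p * (k′ + k)         ∎)
  where open ≡-Reasoning

-- Euclid's lemma cancels `a` from `p ∣ a * (a ^ (p ∸ 1) ∸ 1)`, where the right side is `a ^ p ∸ a`.
fermat : Prime p → ∀ {a} → p ∤ a → p ∣ a ^ (p ∸ 1) ∸ 1
fermat {zero}        pr     p∤a = contradiction pr ¬prime[0]
fermat {p@(suc p-1)} pr {a} p∤a with euclidsLemma a (a ^ p-1 ∸ 1) pr p∣a*
  where
  p∣a* : p ∣ a * (a ^ p-1 ∸ 1)
  p∣a* with k , eq ← a^p≡a+pk pr a = divides k (begin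
    a * (a ^ p-1 ∸ 1)         ≡⟨ *-distribˡ-∸ a (a ^ p-1) 1 ⟩
    a * a ^ p-1 ∸ a * 1       ≡⟨ cong₂ _∸_ eq (*-identityʳ a) ⟩
    a + p * k ∸ a             ≡⟨ m+n∸m≡n a (p * k) ⟩
    p * k                     ≡⟨ *-comm p k ⟩
    k * p                     ∎)
    where open ≡-Reasoning
... | inj₁ p∣a  = contradiction p∣a p∤a
... | inj₂ p∣a- = p∣a-

-- Euclid's lemma strips one factor `p` at a time from `a`.
p^s∣a*b⇒p^s∣a : Prime p → ∀ s {a b} → p ∤ b → p ^ s ∣ a * b → p ^ s ∣ a
p^s∣a*b⇒p^s∣a pr zero    p∤b _ = 1∣ _
p^s∣a*b⇒p^s∣a {p} pr (suc s) {a} {b} p∤b div with euclidsLemma a b pr (∣-trans (m∣m*n (p ^ s)) div)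
... | inj₂ p∣b = contradiction p∣b p∤b
... | inj₁ (divides a′ refl) = subst (p * p ^ s ∣_) (*-comm p a′) (*-monoʳ-∣ p
  (p^s∣a*b⇒p^s∣a pr s p∤b (*-cancelˡ-∣ p (subst (p * p ^ s ∣_)
    (trans (cong (_* b) (*-comm a′ p)) (*-assoc p a′ b)) div))))
  where instance _ = prime⇒nonZero pr

-- For odd p the second condition follows from the first; for p = 2 it says
-- 4 ∣ y.  It makes (1 + y)^p ∸ 1 divisible by exactly one more p than y.
Liftable : ℕ → ℕ → Set
Liftable p y = p ∣ y × p * p ∣ y * (p C 2)

liftable-∣ : ∀ {x y} → x ∣ y → Liftable p x → Liftable p y
liftable-∣ {p = p} x∣y (p∣x , pp∣) = ∣-trans p∣x x∣y , ∣-trans pp∣ (*-monoˡ-∣ (p C 2) x∣y)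

-- With `y = x ∸ 1`, `x ^ n ∸ 1` is `y * (n + y * k)`, and the cofactor is `n` modulo `p`, hence
-- prime to `p`.
lift-coprime : Prime p → ∀ s {x n} → p ∣ x ∸ 1 → p ∤ n →
               p ^ suc s ∤ x ∸ 1 → p ^ suc s ∤ x ^ n ∸ 1
lift-coprime pr s {zero}  _   _   p^∤x-1 = contradiction (_ ∣0) p^∤x-1
lift-coprime {p} pr s {suc y} {n} p∣y p∤n p^∤x-1 div with k , eq ← binomial₂ y n =
  p^∤x-1 (p^s∣a*b⇒p^s∣a pr (suc s) {y} {n + y * k}
      (λ p∣ → p∤n (∣m+n∣m⇒∣n (subst (p ∣_) (+-comm n (y * k)) p∣) (∣m⇒∣m*n k p∣y)))
      (subst (p ^ suc s ∣_) eq div))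

-- Here the cofactor of `y` is `p + y * (p C 2) + y * y * k`. Both products are multiples of `p * p`
-- by `Liftable`, so exactly one `p` divides the cofactor.
lift-p : Prime p → ∀ s {x} → Liftable p (x ∸ 1) →
         p ^ suc s ∤ x ∸ 1 → p ^ suc (suc s) ∤ x ^ p ∸ 1
lift-p pr s {zero} _ p^∤x-1 = contradiction (_ ∣0) p^∤x-1
lift-p {p} pr s {suc y} (divides y′ y≡ , divides j yC≡) p^∤x-1 div with k , eq ← binomial₃ y p =
  p^∤x-1 (p^s∣a*b⇒p^s∣a pr (suc s) {y} {1 + p * (j + y′ * y′ * k)} p∤
      (*-cancelˡ-∣ p (subst (p ^ suc (suc s) ∣_) (trans (cong (_∸ 1) eq) factor) div)))
  where
  open ≡-Reasoning
  instance _ = prime⇒nonZero pr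
  p∤ : p ∤ 1 + p * (j + y′ * y′ * k)
  p∤ p∣ = ¬prime[1] (subst Prime (∣1⇒≡1 (∣m+n∣m⇒∣n
    (subst (p ∣_) (+-comm 1 (p * (j + y′ * y′ * k))) p∣) (m∣m*n _))) pr)
  inner : p + y * (p C 2 + y * k) ≡ p * (1 + p * (j + y′ * y′ * k))
  inner = begin
    p + y * (p C 2 + y * k)                        ≡⟨ cong (p +_) (*-distribˡ-+ y (p C 2) (y * k)) ⟩
    p + (y * (p C 2) + y * (y * k))                ≡⟨ cong₂ (λ u v → p + (u + v * (v * k))) yC≡ y≡ ⟩
    p + (j * (p * p) + y′ * p * (y′ * p * k))      ≡⟨ identity p j y′ k ⟩
    p * (1 + p * (j + y′ * y′ * k))                ∎
    where
    identity : ∀ p j y k → p + (j * (p * p) + y * p * (y * p * k)) ≡ p * (1 + p * (j + y * y * k))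
    identity = solve-∀
  factor : y * (p + y * (p C 2 + y * k)) ≡ p * (y * (1 + p * (j + y′ * y′ * k)))
  factor = begin
    y * (p + y * (p C 2 + y * k))               ≡⟨ cong (y *_) inner ⟩
    y * (p * (1 + p * (j + y′ * y′ * k)))       ≡⟨ x∙yz≈y∙xz y p _ ⟩
    p * (y * (1 + p * (j + y′ * y′ * k)))       ∎
    where open CommutativeSemigroupProperties *-commutativeSemigroup using (x∙yz≈y∙xz)

-- Induction on `f`: passing from `x` to `x ^ p` raises the multiplicity by at most one and keeps
-- liftability; the factor `n` prime to `p` is handled at the end.
lifting-the-exponent : Prime p → ∀ f {s x n} → p ∤ n → Liftable p (x ∸ 1) →
                       p ^ suc s ∤ x ∸ 1 → p ^ suc (s + f) ∤ x ^ (p ^ f * n) ∸ 1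
lifting-the-exponent {p} pr zero {s} {x} {n} p∤n (p∣x-1 , _) p^∤x-1 =
  subst₂ (λ e e′ → p ^ suc e ∤ x ^ e′ ∸ 1) (sym (+-identityʳ s)) (sym (*-identityˡ n))
    (lift-coprime pr s {x} {n} p∣x-1 p∤n p^∤x-1)
lifting-the-exponent {p} pr (suc f) {s} {x} {n} p∤n liftable p^∤x-1 =
  subst₂ (λ e z → p ^ suc e ∤ z ∸ 1) (sym (+-suc s f))
    (trans (^-*-assoc x p (p ^ f * n)) (cong (x ^_) (sym (*-assoc p (p ^ f) n))))
    (lifting-the-exponent pr f {suc s} {x ^ p} p∤n
      (liftable-∣ (x∸1∣x^n∸1 x p) liftable) (lift-p pr s {x} liftable p^∤x-1))

-- Valuations, orders and the part prime to m

module _ {P : Pred ℕ 0ℓ} (P? : Decidable P) where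

  greatest-upper : ∀ default {bound k} → k ≤ bound → P k → k ≤ greatest P? default bound
  greatest-upper default {zero} z≤n P0 = z≤n
  greatest-upper default {suc n} {k} k≤1+n Pk with P? (suc n)
  ... | yes _ = k≤1+n
  ... | no ¬P[1+n] with m≤n⇒m<n∨m≡n k≤1+n
  ...   | inj₁ (s≤s k≤n) = greatest-upper default k≤n Pk
  ...   | inj₂ refl      = contradiction Pk ¬P[1+n]

  greatest-satisfies : ∀ {default} bound → P default → P (greatest P? default bound)
  greatest-satisfies zero Pd with P? 0
  ... | yes P0 = P0
  ... | no  _  = Pd
  greatest-satisfies (suc n) Pd with P? (suc n)
  ... | yes P[1+n] = P[1+n]
  ... | no  _      = greatest-satisfies n Pd

  least-satisfies : ∀ {start} fuel {k} → start ≤ k → k < start + fuel → P k →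
                    P (least P? start fuel) × start ≤ least P? start fuel
  least-satisfies {start} zero start≤k k<start+0 Pk =
    contradiction (<-≤-trans k<start+0 (≤-reflexive (+-identityʳ start))) (≤⇒≯ start≤k)
  least-satisfies {start} (suc fuel) {k} start≤k k< Pk with P? start
  ... | yes Pstart = Pstart , ≤-refl
  ... | no ¬Pstart with m≤n⇒m<n∨m≡n start≤k
  ...   | inj₂ refl = contradiction Pk ¬Pstart
  ...   | inj₁ start<k with least-satisfies fuel start<k (subst (k <_) (+-suc start fuel) k<) Pk
  ...     | Pleast , start< = Pleast , <⇒≤ start<

n<p^n : 1 < p → ∀ n → n < p ^ n
n<p^n 1<p zero = z<s
n<p^n {p} 1<p (suc n) = begin-strict
  suc n          <⟨ +-monoʳ-< 1 (n<p^n 1<p n) ⟩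
  1 + p ^ n      ≤⟨ +-monoˡ-≤ (p ^ n) (≤-trans (s≤s z≤n) (n<p^n 1<p n)) ⟩
  p ^ n + p ^ n  ≡⟨ cong (p ^ n +_) (+-identityʳ (p ^ n)) ⟨
  2 * p ^ n      ≤⟨ *-monoˡ-≤ (p ^ n) 1<p ⟩
  p * p ^ n      ∎
  where open ≤-Reasoning

^-monoʳ-∣ : ∀ x {i j} → i ≤ j → x ^ i ∣ x ^ j
^-monoʳ-∣ x {i} {j} i≤j = subst (x ^ i ∣_)
  (trans (sym (^-distribˡ-+-* x i (j ∸ i))) (cong (x ^_) (m+[n∸m]≡n i≤j)))
  (m∣m*n (x ^ (j ∸ i)))

p^ν∣n : ∀ p n → p ^ ν p n ∣ n
p^ν∣n p n = greatest-satisfies (λ k → p ^ k ∣? n) n (1∣ n)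

p^[1+ν]∤n : 1 < p → ∀ n .{{_ : NonZero n}} → p ^ suc (ν p n) ∤ n
p^[1+ν]∤n {p} 1<p n div = 1+n≰n (greatest-upper (λ k → p ^ k ∣? n) 0
  (<⇒≤ (<-≤-trans (n<p^n 1<p (suc (ν p n))) (∣⇒≤ div))) div)

prime>1 : Prime p → 1 < p
prime>1 pr = nonTrivial⇒n>1 _ {{prime⇒nonTrivial pr}}

ν-split : 1 < p → ∀ n .{{_ : NonZero n}} → ∃ λ c → n ≡ p ^ ν p n * c × p ∤ c
ν-split {p} 1<p n with p^ν∣n p n
... | divides c n≡ = c , trans n≡ (*-comm c (p ^ ν p n)) , λ p∣c →
  p^[1+ν]∤n 1<p n (subst (p ^ suc (ν p n) ∣_) (sym n≡) (*-monoˡ-∣ (p ^ ν p n) p∣c))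

p≤P⁺ : Prime p → ∀ n .{{_ : NonZero n}} → p ∣ n → p ≤ P⁺ n
p≤P⁺ pr n p∣n = greatest-upper (primeDivisor? n) 1 (∣⇒≤ p∣n) (pr , p∣n)

-- Fermat supplies the exponent `p ∸ 1`, which lies in the range searched by `ord`.
ord-prime : Prime p → p ∤ m → p ∣ m ^ ord p m ∸ 1 × 1 ≤ ord p m
ord-prime {p} {m} pr p∤m =
  least-satisfies (λ k → p ∣? (m ^ k ∸ 1)) p {p ∸ 1} (m<n⇒0<n∸m (prime>1 pr))
    (s≤s (m∸n≤m p 1)) (fermat pr p∤m)

p∤m^n : Prime p → p ∤ m → ∀ n → p ∤ m ^ n
p∤m^n pr p∤m zero    p∣1 = p∤1 pr p∣1
p∤m^n pr p∤m (suc n) p∣  = [ p∤m , p∤m^n pr p∤m n ]′ (euclidsLemma _ _ pr p∣)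

p∤m*n : Prime p → p ∤ m → p ∤ n → p ∤ m * n
p∤m*n pr p∤m p∤n p∣ = [ p∤m , p∤n ]′ (euclidsLemma _ _ pr p∣)

prime∣prime : Prime p → Prime q → p ∣ q → p ≡ q
prime∣prime {p} {q} prp prq p∣q with prime⇒irreducible prq p∣q
... | inj₁ refl = contradiction prp ¬prime[1]
... | inj₂ p≡q = p≡q

p^s*b∣n : Prime p → ∀ s {b n} → p ∤ b → p ^ s ∣ n → b ∣ n → p ^ s * b ∣ n
p^s*b∣n {p} pr s {b} p∤b p^s∣n (divides c refl) = *-monoˡ-∣ b (p^s∣a*b⇒p^s∣a pr s {c} p∤b p^s∣n)

product-powers∣ : (f : ℕ → ℕ) → ∀ {ps n} → Unique ps → All Prime ps →
                  (∀ {p} → p ∈ ps → p ^ f p ∣ n) → product (map (λ p → p ^ f p) ps) ∣ n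
product-powers∣ f {[]}     []         []         powers = 1∣ _
product-powers∣ f {p ∷ ps} (p∉ ∷ uniq) (pr ∷ prs) powers =
  p^s*b∣n pr (f p) (p∤product p∉ prs) (powers (here refl))
    (product-powers∣ f uniq prs (powers ∘ there))
  where
  p∤product : ∀ {qs} → All (p ≢_) qs → All Prime qs → p ∤ product (map (λ q → q ^ f q) qs)
  p∤product []         []           = p∤1 pr
  p∤product {q ∷ qs} (p≢q ∷ p≢qs) (prq ∷ prqs) =
    p∤m*n pr (p∤m^n pr (p≢q ∘ prime∣prime pr prq) (f q)) (p∤product p≢qs prqs)

product-powers∣m^ : (f : ℕ → ℕ) → ∀ {ps} → All (_∣ m) ps →
                    ∃ λ J → product (map (λ p → p ^ f p) ps) ∣ m ^ J
product-powers∣m^ f [] = 0 , ∣-refl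
product-powers∣m^ {m} f {p ∷ ps} (p∣m ∷ rest) with J , div ← product-powers∣m^ f rest =
  f p + J , subst (_ ∣_) (sym (^-distribˡ-+-* m (f p) J)) (*-pres-∣ (^-monoˡ-∣ (f p)) div)
  where
  ^-monoˡ-∣ : ∀ e → p ^ e ∣ m ^ e
  ^-monoˡ-∣ zero    = ∣-refl
  ^-monoˡ-∣ (suc e) = *-pres-∣ p∣m (^-monoˡ-∣ e)

module _ (m A : ℕ) .{{m≢0 : NonZero m}} .{{A≢0 : NonZero A}} where

  private
    instance
      _ = mPart≢0 m A
    primeDivisors-prime : All (λ p → Prime p × p ∣ m) (primeDivisors m)
    primeDivisors-prime = All.all-filter (primeDivisor? m) (upTo (suc m))

  mPart∣A : mPart m A ∣ A
  mPart∣A = product-powers∣ (λ p → ν p A) (Unique.filter⁺ (primeDivisor? m) (Unique.upTo⁺ (suc m)))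
    (All.map proj₁ primeDivisors-prime) (λ {p} _ → p^ν∣n p A)

  mPart∣m^ : ∃ λ J → mPart m A ∣ m ^ J
  mPart∣m^ = product-powers∣m^ (λ p → ν p A) (All.map proj₂ primeDivisors-prime)

  mPart*primeToPart : mPart m A * primeToPart m A ≡ A
  mPart*primeToPart = m*[n/m]≡n mPart∣A

  -- The m-part contains the full power `p ^ ν p A`; another `p` in the cofactor would make
  -- `p ^ suc (ν p A)` divide `A`.
  primeToPart-coprime : Prime p → p ∣ m → p ∤ primeToPart m A
  primeToPart-coprime {p} pr p∣m p∣Q = p^[1+ν]∤n (prime>1 pr) A
    (subst₂ _∣_ (*-comm (p ^ ν p A) p) mPart*primeToPart (*-pres-∣ p^ν∣mPart p∣Q))
    where
    p^ν∣mPart : p ^ ν p A ∣ mPart m A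
    p^ν∣mPart = ∈⇒∣product (∈-map⁺ (λ q → q ^ ν q A)
      (∈-filter⁺ (primeDivisor? m) (∈-upTo⁺ (s≤s (∣⇒≤ p∣m))) (pr , p∣m)))

-- The powers of m modulo Q

-- The exponent is built from the orders p - 1 modulo the primes p; only the
-- largest power of p₀ among them enters, and raising to the p-th power
-- raises the multiplicity of p.
annihilating-exponent : ∀ {p₀ P} → Prime p₀ → 2 ≤ P → ∀ {ps} →
  All (λ p → Prime p × p ∤ m × p₀ ≢ p × p ≤ P) ps →
  ∃₂ λ f g → p₀ ∤ g × p₀ ^ f ≤ P ∸ 1 × product ps ∣ m ^ (p₀ ^ f * g) ∸ 1
annihilating-exponent {p₀ = p₀} pr₀ 2≤P [] =
  0 , 1 , p∤1 pr₀ , m<n⇒0<n∸m 2≤P , 1∣ _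
annihilating-exponent {m} {p₀} {P} pr₀ 2≤P {p ∷ ps} ((pr , p∤m , p₀≢p , p≤P) ∷ rest)
  with f , g , p₀∤g , p₀^f≤ , R∣ ← annihilating-exponent {m} pr₀ 2≤P rest
  with g′ , p-1≡ , p₀∤g′ ← ν-split (prime>1 pr₀) (p ∸ 1) {{>-nonZero (m<n⇒0<n∸m (prime>1 pr))}} =
    -- The maximum of the two `p₀`-exponents, rather than their sum, preserves `p₀ ^ f ≤ P ∸ 1`. The
    -- last factor `p` accounts for repeated primes in the list; it differs from `p₀`, so it goes
    -- into `g`.
    f ⊔ e , g * g′ * p
  , p∤m*n pr₀ (p∤m*n pr₀ p₀∤g p₀∤g′) (p₀≢p ∘ prime∣prime pr₀ pr)
  , bound
  , subst (λ z → p * product ps ∣ z ∸ 1)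
      (trans (^-*-assoc m H p) (cong (m ^_) (*-assoc (p₀ ^ (f ⊔ e)) (g * g′) p)))
      (p-fold (m ^ H) p∣m^H-1 R∣m^H-1)
  where
  e = ν p₀ (p ∸ 1)
  H = p₀ ^ (f ⊔ e) * (g * g′)
  bound : p₀ ^ (f ⊔ e) ≤ P ∸ 1
  bound with ⊔-sel f e
  ... | inj₁ eq rewrite eq = p₀^f≤
  ... | inj₂ eq rewrite eq = ≤-trans
    (∣⇒≤ {{>-nonZero (m<n⇒0<n∸m (prime>1 pr))}} (p^ν∣n p₀ (p ∸ 1))) (∸-monoˡ-≤ 1 p≤P)
  R∣m^H-1 : product ps ∣ m ^ H ∸ 1
  R∣m^H-1 = ∣-trans R∣ (x^m∸1∣x^n∸1 m (*-pres-∣ (^-monoʳ-∣ p₀ (m≤m⊔n f e)) (m∣m*n g′)))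
  p∣m^H-1 : p ∣ m ^ H ∸ 1
  p∣m^H-1 = ∣-trans (fermat pr p∤m) (x^m∸1∣x^n∸1 m (subst (_∣ H) (sym p-1≡)
    (*-pres-∣ (^-monoʳ-∣ p₀ (m≤n⊔m f e)) (n∣m*n g))))
  -- With `y = x ∸ 1`, `x ^ p ∸ 1` is `y * (p + y * k)`: `R` divides the first factor and `p` the
  -- second.
  p-fold : ∀ x {p R} → p ∣ x ∸ 1 → R ∣ x ∸ 1 → p * R ∣ x ^ p ∸ 1
  p-fold zero    {zero}  p∣ R∣ = ∣-refl
  p-fold zero    {suc p} p∣ R∣ = _ ∣0
  p-fold (suc y) {p} {R} p∣ R∣ with k , eq ← binomial₂ y p =
    subst₂ _∣_ (*-comm R p) (sym eq) (*-pres-∣ R∣ (∣m∣n⇒∣m+n ∣-refl (∣m⇒∣m*n k p∣)))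

exact-power : ∀ p σ {y} → p ^ suc σ ∤ y → ∃ λ s → s ≤ σ × p ^ s ∣ y × p ^ suc s ∤ y
exact-power p zero    p∤y = 0 , z≤n , 1∣ _ , p∤y
exact-power p (suc σ) {y} ∤y with p ^ suc σ ∣? y
... | yes div = suc σ , ≤-refl , div , ∤y
... | no ndiv with s , s≤σ , div , ndiv′ ← exact-power p σ ndiv = s , m≤n⇒m≤1+n s≤σ , div , ndiv′

odd-liftable : ∀ {y} → Prime p → p ≢ 2 → p ∣ y → Liftable p y
odd-liftable pr p≢2 p∣y = p∣y , *-pres-∣ p∣y (p∣pCk pr z<s (≤∧≢⇒< (prime>1 pr) (p≢2 ∘ sym)))

-- Odd squares are 1 modulo 4, and `2 C 2` is 1.
odd-square : 2 ∤ m → Liftable 2 (m ^ 2 ∸ 1)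
odd-square {m} 2∤m = ∣-trans (divides 2 refl) 4∣ , ∣m⇒∣m*n 1 4∣
  where
  half : ∀ m → (∃ λ k → m ≡ k * 2) ⊎ (∃ λ k → m ≡ suc (k * 2))
  half zero    = inj₁ (0 , refl)
  half (suc m) with half m
  ... | inj₁ (k , eq) = inj₂ (k , cong suc eq)
  ... | inj₂ (k , eq) = inj₁ (suc k , cong suc eq)
  4∣ : 4 ∣ m ^ 2 ∸ 1
  4∣ with half m
  ... | inj₁ (k , eq) = contradiction (divides k eq) 2∤m
  ... | inj₂ (k , refl) = divides (k * k + k) (cong (_∸ 1) (identity k))
    where
    identity : ∀ k → suc (k * 2) ^ 2 ≡ suc ((k * k + k) * 4)
    identity k = trans (cong (suc (k * 2) *_) (*-identityʳ _)) (identity′ k)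
      where
      identity′ : ∀ k → suc (k * 2) * suc (k * 2) ≡ suc ((k * k + k) * 4)
      identity′ = solve-∀

overhead-odd : ∀ m → p ≢ 2 → overhead m p ≡ ν p (m ^ ord p m ∸ 1)
overhead-odd {p} m p≢2 =
  cong (λ b → if b then ν 2 (m ^ 2 ∸ 1) ∸ 1 else ν p (m ^ ord p m ∸ 1)) (dec-false (p ≟ 2) p≢2)

-- For p = 2 one passes to m ^ 2, at the cost of a factor 2.
liftable-power : Prime p → 2 ≤ m → p ∤ m → ∃₂ λ h τ →
  Liftable p (m ^ h ∸ 1) × p ^ suc τ ∤ m ^ h ∸ 1 × p ^ τ ≤ 2 * p ^ overhead m p
liftable-power {p} {m} pr 2≤m p∤m with p ≟ 2
... | yes refl = 2 , ν 2 (m ^ 2 ∸ 1) , odd-square p∤m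
  , p^[1+ν]∤n (prime>1 pr) (m ^ 2 ∸ 1) {{>-nonZero (m<n⇒0<n∸m (≤-trans 2≤m
      (≤-trans (≤-reflexive (sym (^-identityʳ m))) (^-monoʳ-≤ m {{>-nonZero (<⇒≤ 2≤m)}} (s≤s (z≤n {1}))))))}}
  , bound (ν 2 (m ^ 2 ∸ 1))
  where
  bound : ∀ e → 2 ^ e ≤ 2 * 2 ^ (e ∸ 1)
  bound zero    = s≤s z≤n
  bound (suc e) = ≤-refl
... | no p≢2 with ord-prime pr p∤m
...   | p∣ , 1≤ord = ord p m , ν p (m ^ ord p m ∸ 1) , odd-liftable pr p≢2 p∣
  , p^[1+ν]∤n (prime>1 pr) (m ^ ord p m ∸ 1) {{>-nonZero (m<n⇒0<n∸m (≤-trans 2≤m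
      (≤-trans (≤-reflexive (sym (^-identityʳ m))) (^-monoʳ-≤ m {{>-nonZero (<⇒≤ 2≤m)}} 1≤ord))))}}
  , subst (λ t → p ^ ν p (m ^ ord p m ∸ 1) ≤ 2 * p ^ t) (sym (overhead-odd m p≢2)) (m≤m+n _ _)

-- With x = m ^ H, the powers x ^ d for 0 ≤ d < p ^ e are congruent to 1
-- modulo M and, if p ∤ m, distinct modulo M * p ^ e = Q.
record Orbit (p m Q κ : ℕ) : Set where
  field
    H M e      : ℕ
    Q≡M*p^e    : Q ≡ M * p ^ e
    M∣m^H∸1    : M ∣ m ^ H ∸ 1
    κ<p^e      : κ < p ^ e
    aperiodic  : ∀ {d} → 0 < d → d < p ^ e → p ^ ν p Q ∤ (m ^ H) ^ d ∸ 1

-- Let `Q = p ^ v * Q′` with `p ∤ Q′`. The exponent `H` combines `h`, which makes `m ^ h ∸ 1`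
-- liftable, with an exponent that makes the power of `m` equal to 1 modulo `Q′`. If `s` is the
-- multiplicity of `p` in `m ^ H ∸ 1`, then `p ^ s ≤ p ^ τ * p ^ f ≤ 2 * p ^ overhead m p * (P ∸
-- 1)`, and `large` leaves `p ^ (v ∸ s)` above `κ`.
orbit : Prime p → 2 ≤ m → p ∤ m → ∀ Q .{{_ : NonZero Q}} {P κ} → 2 ≤ P →
        (∀ {q} → Prime q → q ∣ Q → q ∤ m × q ≤ P) → 1 ≤ κ →
        p ^ overhead m p * ((P ∸ 1) * (2 * κ)) < p ^ ν p Q →
        Orbit p m Q κ
orbit {p} {m} pr 2≤m p∤m Q {P} {κ} 2≤P primes 1≤κ large
  with Q′ , Q≡ , p∤Q′ ← ν-split (prime>1 pr) Q
  with h , τ , liftable , ∤m^h-1 , p^τ≤ ← liftable-power pr 2≤m p∤m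
  with record { factors = ps ; isFactorisation = Q′≡ ; factorsPrime = prs }
       ← factorise Q′ {{≢-nonZero λ { refl → p∤Q′ (p ∣0) }}}
  with f , g , p∤g , p^f≤ , Q′∣′ ← annihilating-exponent {m} pr 2≤P (All.tabulate λ {q} q∈ps →
         let prq  = All.lookup prs q∈ps
             q∣Q′ = subst (q ∣_) (sym Q′≡) (∈⇒∣product q∈ps)
             (q∤m , q≤P) = primes prq (subst (q ∣_) (sym Q≡) (∣n⇒∣m*n (p ^ ν p Q) q∣Q′))
         in prq , q∤m , (λ { refl → p∤Q′ q∣Q′ }) , q≤P)
  with s , s≤ , p^s∣ , p^[1+s]∤ ← exact-power p (τ + f)
         (lifting-the-exponent pr f {τ} {m ^ h} p∤g liftable ∤m^h-1)
  = record
  { H         = H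
  ; M         = p ^ s * Q′
  ; e         = v ∸ s
  ; Q≡M*p^e   = Q≡M*p^[v-s]
  ; M∣m^H∸1   = subst (λ w → p ^ s * Q′ ∣ w ∸ 1) z≡m^H (p^s*b∣n pr s p∤Q′ p^s∣ Q′∣)
  ; κ<p^e     = *-cancelˡ-< (p ^ s) κ (p ^ (v ∸ s)) (subst (p ^ s * κ <_) (sym p^s*p^[v-s]) p^s*κ<p^v)
  ; aperiodic = aperiodic
  }
  where
  v = ν p Q
  H = h * (p ^ f * g)
  z = (m ^ h) ^ (p ^ f * g)
  instance
    _ = prime⇒nonZero pr
    _ = m^n≢0 p s
  z≡m^H : z ≡ m ^ H
  z≡m^H = ^-*-assoc m h (p ^ f * g)
  Q′∣ : Q′ ∣ z ∸ 1
  Q′∣ = subst₂ (λ u w → u ∣ w ∸ 1) (sym Q′≡) (sym z≡m^H)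
    (∣-trans Q′∣′ (x^m∸1∣x^n∸1 m (n∣m*n h)))
  p^s*κ<p^v : p ^ s * κ < p ^ v
  p^s*κ<p^v = begin-strict
    p ^ s * κ                                        ≤⟨ *-monoˡ-≤ κ (^-monoʳ-≤ p s≤) ⟩
    p ^ (τ + f) * κ                                  ≡⟨ cong (_* κ) (^-distribˡ-+-* p τ f) ⟩
    p ^ τ * p ^ f * κ                                ≤⟨ *-monoˡ-≤ κ (*-mono-≤ p^τ≤ p^f≤) ⟩
    2 * p ^ overhead m p * (P ∸ 1) * κ               ≡⟨ rearrange (p ^ overhead m p) (P ∸ 1) κ ⟩
    p ^ overhead m p * ((P ∸ 1) * (2 * κ))           <⟨ large ⟩
    p ^ v                                            ∎
    where
    open ≤-Reasoning
    rearrange : ∀ a b c → 2 * a * b * c ≡ a * (b * (2 * c))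
    rearrange = solve-∀
  s≤v : s ≤ v
  s≤v = ≮⇒≥ λ v<s → <⇒≱ p^s*κ<p^v (≤-trans (^-monoʳ-≤ p (<⇒≤ v<s))
    (≤-trans (≤-reflexive (sym (*-identityʳ (p ^ s)))) (*-monoʳ-≤ (p ^ s) 1≤κ)))
  p^s*p^[v-s] : p ^ s * p ^ (v ∸ s) ≡ p ^ v
  p^s*p^[v-s] = trans (sym (^-distribˡ-+-* p s (v ∸ s))) (cong (p ^_) (m+[n∸m]≡n s≤v))
  Q≡M*p^[v-s] : Q ≡ p ^ s * Q′ * p ^ (v ∸ s)
  Q≡M*p^[v-s] = trans Q≡ (trans (cong (_* Q′) (sym p^s*p^[v-s])) (swap (p ^ s) (p ^ (v ∸ s)) Q′))
    where
    swap : ∀ a b c → a * b * c ≡ a * c * b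
    swap = solve-∀
  -- Since `d < p ^ (v ∸ s)`, the multiplicity of `p` in `d` is below `v ∸ s`, so lifting the
  -- exponent keeps that of `z ^ d ∸ 1` below `v`.
  aperiodic : ∀ {d} → 0 < d → d < p ^ (v ∸ s) → p ^ v ∤ (m ^ H) ^ d ∸ 1
  aperiodic {d} 0<d d<p^[v-s] p^v∣ with c , d≡ , p∤c ← ν-split (prime>1 pr) d {{>-nonZero 0<d}} =
    lifting-the-exponent pr (ν p d) {s} {z} p∤c
      (liftable-∣ (x∸1∣x^n∸1 (m ^ h) (p ^ f * g)) liftable) p^[1+s]∤
      (∣-trans (^-monoʳ-∣ p 1+s+νd≤v)
        (subst₂ (λ w e → p ^ v ∣ w ^ e ∸ 1) (sym z≡m^H) d≡ p^v∣))
    where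
    νd<v-s : ν p d < v ∸ s
    νd<v-s = ≰⇒> λ v-s≤νd → <⇒≱ d<p^[v-s]
      (≤-trans (^-monoʳ-≤ p v-s≤νd) (∣⇒≤ {{>-nonZero 0<d}} (p^ν∣n p d)))
    1+s+νd≤v : suc (s + ν p d) ≤ v
    1+s+νd≤v = begin
      suc (s + ν p d)  ≡⟨ +-suc s (ν p d) ⟨
      s + suc (ν p d)  ≤⟨ +-monoʳ-≤ s νd<v-s ⟩
      s + (v ∸ s)      ≡⟨ m+[n∸m]≡n s≤v ⟩
      v                ∎
      where open ≤-Reasoning

-- Digits of equally spaced points

open import Data.Fin.Subset using (∣_∣)

-- Induction on `n`: deleting the value at `zero` from `D` lowers its size, and injectivity keeps
-- the other values inside.
injection-into⇒≤ : ∀ n {m} (D : Subset m) (f : Fin n → Fin m) →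
                   Injective _≡_ _≡_ f → (∀ i → f i Subset.∈ D) → n ≤ ∣ D ∣
injection-into⇒≤ zero    D f inj f∈D = z≤n
injection-into⇒≤ (suc n) D f inj f∈D = ≤-trans
  (s≤s (injection-into⇒≤ n (D Subset.- f Fin.zero) (f ∘ Fin.suc) (Fin.suc-injective ∘ inj)
    (λ i → Subset.x∈p∧x≢y⇒x∈p-y (f∈D (Fin.suc i)) (λ eq → contradiction (inj eq) λ ()))))
  (Subset.x∈p⇒∣p-x∣<∣p∣ (f∈D Fin.zero))

missing-element : ∀ {m} (D : Subset m) → ∣ D ∣ < m → ∃ λ d → d Subset.∉ D
missing-element {m} D #D<m = Fin.¬∀⟶∃¬ m (Subset._∈ D) (Subset._∈? D) λ all∈D →
  <⇒≱ #D<m (subst (_≤ ∣ D ∣) (Subset.∣⊤∣≡n m) (Subset.p⊆q⇒∣p∣≤∣q∣ {p = ⊤} {q = D} (λ {i} _ → all∈D i)))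

-- A missed point `i` could be punched out, giving an injection of `Fin (suc n)` into `Fin n`.
endo-injective⇒surjective : ∀ {n} (f : Fin n → Fin n) → Injective _≡_ _≡_ f → ∀ i → ∃ λ j → f j ≡ i
endo-injective⇒surjective {suc n} f inj i with Fin.any? (λ j → f j Fin.≟ i)
... | yes hit = hit
... | no miss = contradiction
  (λ {j} {k} eq → inj (Fin.punchOut-injective (miss′ j) (miss′ k) eq))
  (Fin.<⇒notInjective {f = λ j → Fin.punchOut (miss′ j)} (n<1+n n))
  where
  miss′ : ∀ j → i ≢ f j
  miss′ j i≡fj = miss (j , sym i≡fj)

-- Descent from `n`: whenever the value at `suc n` is at least `a + Q`, the step bound forces
-- `a ≤ f n`, and the start lies below `a + Q`.
discrete-ivt : ∀ (f : ℕ → ℕ) {Q a} → f 0 < a + Q → (∀ k → f (suc k) ≤ f k + Q) →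
               ∀ n → a ≤ f n → ∃ λ k → a ≤ f k × f k < a + Q
discrete-ivt f f0< step zero    a≤f0 = 0 , a≤f0 , f0<
discrete-ivt f {Q} {a} f0< step (suc n) a≤f with f (suc n) <? a + Q
... | yes f< = suc n , a≤f , f<
... | no  f≮ = discrete-ivt f f0< step n
  (+-cancelʳ-≤ Q a (f n) (≤-trans (≮⇒≥ f≮) (step n)))

-- N points of the form ρ + M κ in [0 , Q), one in each class, are spaced by
-- M = Q / N.  If N > m, every interval of length Q / m contains one of them;
-- otherwise each contains at most one.
equidistributed-digits : ∀ {m} (D : Subset m) → ∣ D ∣ < m → ∀ {M N ρ} → ρ < M →
  (κ : Fin N → Fin N) → Injective _≡_ _≡_ κ →
  (δ : Fin N → Fin m) → (∀ j → δ j Subset.∈ D) →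
  (∀ j → toℕ (δ j) * (M * N) ≤ m * (ρ + M * toℕ (κ j))
       × m * (ρ + M * toℕ (κ j)) < suc (toℕ (δ j)) * (M * N)) →
  N ≤ ∣ D ∣
equidistributed-digits {m} D #D<m {M} {N} {ρ} ρ<M κ κ-inj δ δ∈D bounds with N ≤? m
... | yes N≤m = injection-into⇒≤ N D δ δ-inj δ∈D
  where
  -- After scaling by `m`, cells have length `M * N` and successive points are `M * m ≥ M * N`
  -- apart, so distinct points lie in distinct cells.
  separated : ∀ i j → toℕ (κ i) < toℕ (κ j) → δ i ≢ δ j
  separated i j κi<κj δi≡δj = <-irrefl refl (begin-strict
    m * (ρ + M * toℕ (κ j))              <⟨ proj₂ (bounds j) ⟩
    M * N + toℕ (δ j) * (M * N)          ≡⟨ cong (λ z → M * N + toℕ z * (M * N)) δi≡δj ⟨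
    M * N + toℕ (δ i) * (M * N)          ≤⟨ +-mono-≤ (*-monoʳ-≤ M N≤m) (proj₁ (bounds i)) ⟩
    M * m + m * (ρ + M * toℕ (κ i))      ≡⟨ rearrange m M ρ (toℕ (κ i)) ⟩
    m * (ρ + M * suc (toℕ (κ i)))        ≤⟨ *-monoʳ-≤ m (+-monoʳ-≤ ρ (*-monoʳ-≤ M κi<κj)) ⟩
    m * (ρ + M * toℕ (κ j))              ∎)
    where
    open ≤-Reasoning
    rearrange : ∀ m M ρ k → M * m + m * (ρ + M * k) ≡ m * (ρ + M * suc k)
    rearrange = solve-∀
  δ-inj : Injective _≡_ _≡_ δ
  δ-inj {i} {j} δi≡δj with <-cmp (toℕ (κ i)) (toℕ (κ j))
  ... | tri< lt _ _ = contradiction δi≡δj (separated i j lt)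
  ... | tri≈ _ eq _ = κ-inj (Fin.toℕ-injective eq)
  ... | tri> _ _ gt = contradiction (sym δi≡δj) (separated j i gt)
... | no N≰m with missing-element D #D<m
-- The scaled points now move by `m * M ≤ M * N`, the length of a cell, so some point lands in the
-- cell of the missing digit `e`.
...   | e , e∉D with discrete-ivt (λ k → m * (ρ + M * k)) {M * N} {toℕ e * (M * N)} at-0 step N at-N
  where
  m≤N = <⇒≤ (≰⇒> N≰m)
  open ≤-Reasoning
  at-0 : m * (ρ + M * 0) < toℕ e * (M * N) + M * N
  at-0 = begin-strict
    m * (ρ + M * 0)            ≡⟨ cong (λ z → m * z) (trans (cong (ρ +_) (*-zeroʳ M)) (+-identityʳ ρ)) ⟩
    m * ρ                      <⟨ *-monoʳ-< m {{>-nonZero (≤-<-trans z≤n #D<m)}} ρ<M ⟩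
    m * M                      ≡⟨ *-comm m M ⟩
    M * m                      ≤⟨ *-monoʳ-≤ M m≤N ⟩
    M * N                      ≤⟨ m≤n+m (M * N) (toℕ e * (M * N)) ⟩
    toℕ e * (M * N) + M * N    ∎
  step : ∀ k → m * (ρ + M * suc k) ≤ m * (ρ + M * k) + M * N
  step k = begin
    m * (ρ + M * suc k)          ≡⟨ rearrange m M ρ k ⟩
    m * (ρ + M * k) + M * m      ≤⟨ +-monoʳ-≤ (m * (ρ + M * k)) (*-monoʳ-≤ M m≤N) ⟩
    m * (ρ + M * k) + M * N      ∎
    where
    rearrange : ∀ m M ρ k → m * (ρ + M * suc k) ≡ m * (ρ + M * k) + M * m
    rearrange = solve-∀
  at-N : toℕ e * (M * N) ≤ m * (ρ + M * N)
  at-N = *-mono-≤ (<⇒≤ (Fin.toℕ<n e)) (m≤n+m (M * N) ρ)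
...     | k , e≤ , <e+1 with endo-injective⇒surjective κ κ-inj (Fin.fromℕ< k<N)
  where
  open ≤-Reasoning
  -- `discrete-ivt` does not bound `k`, but the cell of `e` ends no later than `m * (M * N)`.
  k<N : k < N
  k<N = *-cancelˡ-< M k N (*-cancelˡ-< m (M * k) (M * N) (begin-strict
    m * (M * k)                  ≤⟨ *-monoʳ-≤ m (m≤n+m (M * k) ρ) ⟩
    m * (ρ + M * k)              <⟨ <e+1 ⟩
    toℕ e * (M * N) + M * N      ≡⟨ +-comm _ (M * N) ⟩
    suc (toℕ e) * (M * N)        ≤⟨ *-monoˡ-≤ (M * N) (Fin.toℕ<n e) ⟩
    m * (M * N)                  ∎))
...       | j , κj≡ = contradiction (subst (Subset._∈ D) δj≡e (δ∈D j)) e∉D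
  where
  bounds-j : toℕ (δ j) * (M * N) ≤ m * (ρ + M * k)
           × m * (ρ + M * k) < suc (toℕ (δ j)) * (M * N)
  bounds-j = subst (λ z → toℕ (δ j) * (M * N) ≤ m * (ρ + M * z) × m * (ρ + M * z) < suc (toℕ (δ j)) * (M * N))
    (trans (cong toℕ κj≡) (Fin.toℕ-fromℕ< _)) (bounds j)
  same-cell : ∀ {a b} → a * (M * N) ≤ m * (ρ + M * k) → m * (ρ + M * k) < suc b * (M * N) → a ≤ b
  same-cell {a} {b} a≤ <1+b = s≤s⁻¹ (*-cancelʳ-< (M * N) a (suc b) (≤-<-trans a≤ <1+b))
  δj≡e : δ j ≡ e
  δj≡e = Fin.toℕ-injective (≤-antisym
    (same-cell (proj₁ bounds-j) (subst (m * (ρ + M * k) <_) (+-comm _ (M * N)) <e+1))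
    (same-cell e≤ (proj₂ bounds-j)))

%-≡⇒∣∸ : ∀ a b n .{{_ : NonZero n}} → a % n ≡ b % n → n ∣ a ∸ b
%-≡⇒∣∸ a b n eq = divides (a / n ∸ b / n) (begin
  a ∸ b                                          ≡⟨ cong₂ _∸_ (m≡m%n+[m/n]*n a n) (m≡m%n+[m/n]*n b n) ⟩
  (a % n + a / n * n) ∸ (b % n + b / n * n)      ≡⟨ cong (λ z → (z + a / n * n) ∸ (b % n + b / n * n)) eq ⟩
  (b % n + a / n * n) ∸ (b % n + b / n * n)      ≡⟨ [m+n]∸[m+o]≡n∸o (b % n) (a / n * n) (b / n * n) ⟩
  a / n * n ∸ b / n * n                          ≡⟨ *-distribʳ-∸ n (a / n) (b / n) ⟨
  (a / n ∸ b / n) * n                            ∎)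
  where open ≡-Reasoning

∣x-1⇒ux%≡u% : ∀ u x n .{{_ : NonZero n}} .{{_ : NonZero x}} → n ∣ x ∸ 1 → u * x % n ≡ u % n
∣x-1⇒ux%≡u% u (suc y) n (divides c refl) = trans
  (cong (_% n) (rearrange u c n)) ([m+kn]%n≡m%n u (u * c) n)
  where
  rearrange : ∀ u c n → u * suc (c * n) ≡ u + u * c * n
  rearrange = solve-∀

-- The positions `H * j` with `j < N` are examined. The remainders there agree modulo `M` and are
-- distinct, so their quotients by `M` permute `Fin N`, and `equidistributed-digits` contradicts
-- `κ<p^e`.
digits-not-all-in : Prime p → p ∤ m → .{{_ : NonZero m}} → ∀ Q .{{_ : NonZero Q}} (D : Subset m) → ∣ D ∣ < m →
  Orbit p m Q ∣ D ∣ → ∀ {u} → p ∤ u → (b : ℕ → Fin m) → (∀ i → b i Subset.∈ D) →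
  ¬ (∀ i → m * (u * m ^ i % Q) ≡ toℕ (b i) * Q + u * m ^ suc i % Q)
digits-not-all-in {p} {m} pr p∤m Q D #D<m orbit {u} p∤u b b∈D digits =
  <⇒≱ κ<p^e (equidistributed-digits D #D<m {M} {N} {u % M} (m%n<n u M) κ κ-inj δ (λ j → b∈D _) bounds)
  where
  open Orbit orbit
  N = p ^ e
  X = m ^ H
  instance
    M≢0 : NonZero M
    M≢0 = ≢-nonZero λ M≡0 → ≢-nonZero⁻¹ Q (trans Q≡M*p^e (cong (_* N) M≡0))
    _ = m^n≢0 m H
  r : ℕ → ℕ
  r j = u * X ^ j % Q
  M∣Q : M ∣ Q
  M∣Q = subst (M ∣_) (sym Q≡M*p^e) (m∣m*n N)
  r%M : ∀ j → r j % M ≡ u % M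
  r%M j = trans (m∣n⇒o%n%m≡o%m M Q (u * X ^ j) M∣Q)
    (∣x-1⇒ux%≡u% u (X ^ j) M {{_}} {{m^n≢0 X j}} (∣-trans M∣m^H∸1 (x∸1∣x^n∸1 X j)))
  r≡ : ∀ j → r j ≡ u % M + M * (r j / M)
  r≡ j = trans (m≡m%n+[m/n]*n (r j) M) (cong₂ _+_ (r%M j) (*-comm (r j / M) M))
  r/M<N : ∀ j → r j / M < N
  r/M<N j = m<n*o⇒m/o<n (subst (r j <_) (trans Q≡M*p^e (*-comm M N)) (m%n<n (u * X ^ j) Q))
  κ : Fin N → Fin N
  κ j = Fin.fromℕ< (r/M<N (toℕ j))
  toℕ-κ : ∀ j → toℕ (κ j) ≡ r (toℕ j) / M
  toℕ-κ j = Fin.toℕ-fromℕ< (r/M<N (toℕ j))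
  -- Equal remainders give `Q ∣ (X ^ (j ∸ i) ∸ 1) * (u * X ^ i)`. As `p` divides neither `u` nor
  -- `m`, the whole `p ^ ν p Q` divides the first factor.
  r-distinct : ∀ i j → i < j → j < N → r i ≢ r j
  r-distinct i j i<j j<N ri≡rj = aperiodic {j ∸ i} (m<n⇒0<n∸m i<j) (≤-<-trans (m∸n≤m j i) j<N)
    (p^s∣a*b⇒p^s∣a pr (ν p Q) {X ^ (j ∸ i) ∸ 1} (p∤m*n pr p∤u (p∤m^n pr (p∤m^n pr p∤m H) i))
      (∣-trans (p^ν∣n p Q) (subst (Q ∣_) difference (%-≡⇒∣∸ (u * X ^ j) (u * X ^ i) Q (sym ri≡rj)))))
    where
    open ≡-Reasoning
    difference : u * X ^ j ∸ u * X ^ i ≡ (X ^ (j ∸ i) ∸ 1) * (u * X ^ i)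
    difference = begin
      u * X ^ j ∸ u * X ^ i                         ≡⟨ cong (λ z → u * X ^ z ∸ u * X ^ i) (m∸n+n≡m (<⇒≤ i<j)) ⟨
      u * X ^ (j ∸ i + i) ∸ u * X ^ i               ≡⟨ cong (λ z → u * z ∸ u * X ^ i) (^-distribˡ-+-* X (j ∸ i) i) ⟩
      u * (X ^ (j ∸ i) * X ^ i) ∸ u * X ^ i         ≡⟨ cong₂ _∸_ (rearrange u (X ^ (j ∸ i)) (X ^ i)) (sym (*-identityˡ (u * X ^ i))) ⟩
      X ^ (j ∸ i) * (u * X ^ i) ∸ 1 * (u * X ^ i)   ≡⟨ *-distribʳ-∸ (u * X ^ i) (X ^ (j ∸ i)) 1 ⟨
      (X ^ (j ∸ i) ∸ 1) * (u * X ^ i)               ∎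
      where
      rearrange : ∀ a b c → a * (b * c) ≡ b * (a * c)
      rearrange = solve-∀
  κ≡⇒r≡ : ∀ i j → κ i ≡ κ j → r (toℕ i) ≡ r (toℕ j)
  κ≡⇒r≡ i j κi≡κj = trans (r≡ (toℕ i)) (trans (cong (λ z → u % M + M * z)
    (trans (sym (toℕ-κ i)) (trans (cong toℕ κi≡κj) (toℕ-κ j)))) (sym (r≡ (toℕ j))))
  κ-inj : Injective _≡_ _≡_ κ
  κ-inj {i} {j} κi≡κj with <-cmp (toℕ i) (toℕ j)
  ... | tri< lt _ _ = contradiction (κ≡⇒r≡ i j κi≡κj) (r-distinct (toℕ i) (toℕ j) lt (Fin.toℕ<n j))
  ... | tri≈ _ eq _ = Fin.toℕ-injective eq
  ... | tri> _ _ gt = contradiction (κ≡⇒r≡ j i (sym κi≡κj)) (r-distinct (toℕ j) (toℕ i) gt (Fin.toℕ<n i))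
  δ : Fin N → Fin m
  δ j = b (H * toℕ j)
  bounds : ∀ j → toℕ (δ j) * (M * N) ≤ m * (u % M + M * toℕ (κ j))
               × m * (u % M + M * toℕ (κ j)) < suc (toℕ (δ j)) * (M * N)
  -- The rewriting turns the scaled point into `m` times the remainder at position `H * toℕ j`,
  -- which `digits` writes as digit times `Q` plus a remainder below `Q`.
  bounds j rewrite toℕ-κ j | sym (r≡ (toℕ j)) | sym Q≡M*p^e | ^-*-assoc m H (toℕ j) | digits (H * toℕ j) =
    m≤m+n _ _ , subst (toℕ (δ j) * Q + u * m ^ suc (H * toℕ j) % Q <_) (+-comm _ Q)
      (+-monoʳ-< (toℕ (δ j) * Q) (m%n<n (u * m ^ suc (H * toℕ j)) Q))

-- The digits of 1 / a

fromℕ-+ : ∀ m n → fromℕ (m + n) ≡ fromℕ m ℚ.+ fromℕ n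
fromℕ-+ zero    n = sym (ℚ.+-identityˡ (fromℕ n))
fromℕ-+ (suc m) n = begin
  fromℕ (suc (m + n))                ≡⟨ fromℕ-suc (m + n) ⟩
  1ℚ ℚ.+ fromℕ (m + n)               ≡⟨ cong (1ℚ ℚ.+_) (fromℕ-+ m n) ⟩
  1ℚ ℚ.+ (fromℕ m ℚ.+ fromℕ n)       ≡⟨ ℚ.+-assoc 1ℚ (fromℕ m) (fromℕ n) ⟨
  1ℚ ℚ.+ fromℕ m ℚ.+ fromℕ n         ≡⟨ cong (ℚ._+ fromℕ n) (fromℕ-suc m) ⟨
  fromℕ (suc m) ℚ.+ fromℕ n          ∎
  where open ≡-Reasoning

fromℕ-* : ∀ m n → fromℕ (m * n) ≡ fromℕ m ℚ.* fromℕ n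
fromℕ-* zero    n = sym (ℚ.*-zeroˡ (fromℕ n))
fromℕ-* (suc m) n = begin
  fromℕ (n + m * n)                          ≡⟨ fromℕ-+ n (m * n) ⟩
  fromℕ n ℚ.+ fromℕ (m * n)                  ≡⟨ cong₂ ℚ._+_ (sym (ℚ.*-identityˡ (fromℕ n))) (fromℕ-* m n) ⟩
  1ℚ ℚ.* fromℕ n ℚ.+ fromℕ m ℚ.* fromℕ n     ≡⟨ ℚ.*-distribʳ-+ (fromℕ n) 1ℚ (fromℕ m) ⟨
  (1ℚ ℚ.+ fromℕ m) ℚ.* fromℕ n               ≡⟨ cong (ℚ._* fromℕ n) (fromℕ-suc m) ⟨
  fromℕ (suc m) ℚ.* fromℕ n                  ∎
  where open ≡-Reasoning

fromℕ-cancel-< : ∀ {m n} → fromℕ m ℚ.< fromℕ n → m < n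
fromℕ-cancel-< lt = ≰⇒> λ n≤m → ℚ.<-irrefl refl (ℚ.<-≤-trans lt (fromℕ-mono-≤ n≤m))

/≡fromℕ*1/ : ∀ k n .{{_ : NonZero n}} → ℤ.+ k ℚ./ n ≡ fromℕ k ℚ.* (ℤ.+ 1 ℚ./ n)
/≡fromℕ*1/ k (suc n) = ℚ.toℚᵘ-injective (ℚᵘ.≃-trans (ℚ.toℚᵘ-fromℚᵘ (ℚᵘ.mkℚᵘ (ℤ.+ k) n))
  (ℚᵘ.≃-sym (ℚᵘ.≃-trans (ℚ.toℚᵘ-homo-* (fromℕ k) (ℤ.+ 1 ℚ./ suc n))
  (ℚᵘ.≃-trans (ℚᵘ.*-cong (ℚ.toℚᵘ-fromℚᵘ (ℚᵘ.mkℚᵘ (ℤ.+ k) 0)) (ℚ.toℚᵘ-fromℚᵘ (ℚᵘ.mkℚᵘ (ℤ.+ 1) n)))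
  (ℚᵘ.*≡* (cong₂ ℤ._*_ (ℤ.*-identityʳ (ℤ.+ k)) (cong (ℤ.+_ ∘ suc) (sym (+-identityʳ n)))))))))

fromℕ*/ : ∀ k n .{{_ : NonZero n}} → fromℕ n ℚ.* (ℤ.+ k ℚ./ n) ≡ fromℕ k
fromℕ*/ k n = begin
  fromℕ n ℚ.* (ℤ.+ k ℚ./ n)                    ≡⟨ cong (fromℕ n ℚ.*_) (/≡fromℕ*1/ k n) ⟩
  fromℕ n ℚ.* (fromℕ k ℚ.* (ℤ.+ 1 ℚ./ n))      ≡⟨ x∙yz≈y∙xz (fromℕ n) (fromℕ k) (ℤ.+ 1 ℚ./ n) ⟩
  fromℕ k ℚ.* (fromℕ n ℚ.* (ℤ.+ 1 ℚ./ n))      ≡⟨ cong (fromℕ k ℚ.*_) (fromℕ*1/≡1 n) ⟩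
  fromℕ k ℚ.* 1ℚ                             ≡⟨ ℚ.*-identityʳ (fromℕ k) ⟩
  fromℕ k                                    ∎
  where
  open ≡-Reasoning
  open CommutativeSemigroupProperties
    (CommutativeRing.*-commutativeSemigroup ℚ.+-*-commutativeRing) using (x∙yz≈y∙xz)

fromℕ[c*d]*1/d : ∀ c d .{{_ : NonZero d}} → fromℕ (c * d) ℚ.* (ℤ.+ 1 ℚ./ d) ≡ fromℕ c
fromℕ[c*d]*1/d c d = trans (cong (ℚ._* (ℤ.+ 1 ℚ./ d)) (fromℕ-* c d))
  (trans (ℚ.*-assoc (fromℕ c) (fromℕ d) (ℤ.+ 1 ℚ./ d))
  (trans (cong (fromℕ c ℚ.*_) (fromℕ*1/≡1 d)) (ℚ.*-identityʳ (fromℕ c))))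

-- Here `S = t / w` and `ε = c / (a * w)`; both inequalities are multiplied by `a * w`.
clear-denominators : ∀ a w .{{_ : NonZero a}} .{{_ : NonZero w}} {S ε t c} →
  fromℕ w ℚ.* S ≡ fromℕ t → fromℕ (a * w) ℚ.* ε ≡ fromℕ c →
  S ℚ.- ε ℚ.< ℤ.+ 1 ℚ./ a → ℤ.+ 1 ℚ./ a ℚ.< S ℚ.+ ε →
  a * t < w + c × w < a * t + c
clear-denominators a w {S} {ε} {t} {c} wS≡t Wε≡c S-ε<1/a 1/a<S+ε =
    fromℕ-cancel-< (subst₂ ℚ._<_ W*S
      (trans (ℚ.*-distribˡ-+ W 1/a ε) (trans (cong₂ ℚ._+_ W*1/a Wε≡c) (sym (fromℕ-+ w c))))
      (ℚ.*-monoʳ-<-pos W {{W>0}} S<1/a+ε))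
  , fromℕ-cancel-< (subst₂ ℚ._<_ W*1/a
      (trans (ℚ.*-distribˡ-+ W S ε) (trans (cong₂ ℚ._+_ W*S Wε≡c) (sym (fromℕ-+ (a * t) c))))
      (ℚ.*-monoʳ-<-pos W {{W>0}} 1/a<S+ε))
  where
  W 1/a : ℚ
  W = fromℕ (a * w)
  1/a = ℤ.+ 1 ℚ./ a
  W>0 : ℚ.Positive W
  W>0 = ℚ.normalize-pos (a * w) 1 {{_}} {{m*n≢0 a w}}
  W*S : W ℚ.* S ≡ fromℕ (a * t)
  W*S = begin
    W ℚ.* S                            ≡⟨ cong (ℚ._* S) (fromℕ-* a w) ⟩
    fromℕ a ℚ.* fromℕ w ℚ.* S          ≡⟨ ℚ.*-assoc (fromℕ a) (fromℕ w) S ⟩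
    fromℕ a ℚ.* (fromℕ w ℚ.* S)        ≡⟨ cong (fromℕ a ℚ.*_) wS≡t ⟩
    fromℕ a ℚ.* fromℕ t                ≡⟨ fromℕ-* a t ⟨
    fromℕ (a * t)                      ∎
    where open ≡-Reasoning
  W*1/a : W ℚ.* 1/a ≡ fromℕ w
  W*1/a = trans (cong (λ z → fromℕ z ℚ.* 1/a) (*-comm a w)) (fromℕ[c*d]*1/d w a)
  S<1/a+ε : S ℚ.< 1/a ℚ.+ ε
  S<1/a+ε = subst (ℚ._< 1/a ℚ.+ ε) (cancel S ε) (ℚ.+-monoˡ-< ε S-ε<1/a)
    where
    open +-*-Solver
    cancel : ∀ p q → (p ℚ.- q) ℚ.+ q ≡ p
    cancel = solve 2 (λ p q → (p :- q) :+ q := p) refl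

module _ {m : ℕ} .{{m≢0 : NonZero m}} (b : ℕ → Fin m) where

  -- The `j`-th partial sum times `m ^ j`; being an integer, it lets the digits be computed within
  -- `ℕ`.
  truncation : ℕ → ℕ
  truncation zero    = 0
  truncation (suc j) = m * truncation j + toℕ (b j)

  scaled-partialSum : ∀ j → fromℕ (m ^ j) ℚ.* partialSum (digitTerm b) j ≡ fromℕ (truncation j)
  scaled-partialSum zero    = refl
  scaled-partialSum (suc j) = begin
    w′ ℚ.* (S ℚ.+ t)                                   ≡⟨ ℚ.*-distribˡ-+ w′ S t ⟩
    w′ ℚ.* S ℚ.+ w′ ℚ.* t                              ≡⟨ cong₂ ℚ._+_ old (fromℕ*/ (toℕ (b j)) (m ^ suc j)) ⟩
    fromℕ (m * truncation j) ℚ.+ fromℕ (toℕ (b j))     ≡⟨ fromℕ-+ (m * truncation j) (toℕ (b j)) ⟨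
    fromℕ (m * truncation j + toℕ (b j))               ∎
    where
    open ≡-Reasoning
    instance _ = m^n≢0 m (suc j)
    w′ = fromℕ (m ^ suc j)
    S = partialSum (digitTerm b) j
    t = digitTerm b j
    old : w′ ℚ.* S ≡ fromℕ (m * truncation j)
    old = begin
      w′ ℚ.* S                               ≡⟨ cong (ℚ._* S) (fromℕ-* m (m ^ j)) ⟩
      fromℕ m ℚ.* fromℕ (m ^ j) ℚ.* S        ≡⟨ ℚ.*-assoc (fromℕ m) (fromℕ (m ^ j)) S ⟩
      fromℕ m ℚ.* (fromℕ (m ^ j) ℚ.* S)      ≡⟨ cong (fromℕ m ℚ.*_) (scaled-partialSum j) ⟩
      fromℕ m ℚ.* fromℕ (truncation j)       ≡⟨ fromℕ-* m (truncation j) ⟨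
      fromℕ (m * truncation j)               ∎

  truncation-lower : ∀ j k → m ^ k * truncation j ≤ truncation (k + j)
  truncation-lower j zero    = ≤-reflexive (*-identityˡ (truncation j))
  truncation-lower j (suc k) = begin
    m * m ^ k * truncation j       ≡⟨ *-assoc m (m ^ k) (truncation j) ⟩
    m * (m ^ k * truncation j)     ≤⟨ *-monoʳ-≤ m (truncation-lower j k) ⟩
    m * truncation (k + j)         ≤⟨ m≤m+n _ _ ⟩
    truncation (suc k + j)         ∎
    where open ≤-Reasoning

  -- Every digit is at most `m ∸ 1`, so the `k` later digits stay short of one unit at position `j`.
  truncation-upper : ∀ j k → truncation (k + j) < m ^ k * suc (truncation j)
  truncation-upper j zero    = ≤-reflexive (sym (*-identityˡ (suc (truncation j))))
  truncation-upper j (suc k) = begin-strict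
    m * truncation (k + j) + toℕ (b (k + j))   <⟨ +-monoʳ-< (m * truncation (k + j)) (Fin.toℕ<n (b (k + j))) ⟩
    m * truncation (k + j) + m                 ≡⟨ +-comm (m * truncation (k + j)) m ⟩
    m + m * truncation (k + j)                 ≡⟨ *-suc m (truncation (k + j)) ⟨
    m * suc (truncation (k + j))               ≤⟨ *-monoʳ-≤ m (truncation-upper j k) ⟩
    m * (m ^ k * suc (truncation j))           ≡⟨ *-assoc m (m ^ k) (suc (truncation j)) ⟨
    m * m ^ k * suc (truncation j)             ∎
    where open ≤-Reasoning

  module _ {a : ℕ} .{{a≢0 : NonZero a}} {x : ℝ} (x≃1/a : x ≃ fromℚ (ℤ.+ 1 ℚ./ a))
           (converges : partialSum (digitTerm b) ⟶ x) where

    approximation : ∀ j → ∃ λ k → a * truncation (k + j) < m ^ (k + j) + m ^ k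
                                × m ^ (k + j) < a * truncation (k + j) + m ^ k
    approximation j = k₀ , clear-denominators a (m ^ n₀) {{a≢0}} {{m^n≢0 m n₀}} (scaled-partialSum n₀) scaled-ε
      (let (_ , S-ε<q , q∈L) = proj₁ close in ℚ.<-trans S-ε<q (proj₁ x≃1/a q∈L))
      -- `≃` compares lower cuts, so `1 / a ≤ q` comes from disjointness: `q < 1 / a` would put `q`
      -- in both cuts of `x`.
      (let (_ , q∈U , q<S+ε) = proj₂ close in
       ℚ.≤-<-trans (ℚ.≮⇒≥ λ q<1/a → ℝ.disjoint x (proj₂ x≃1/a q<1/a) q∈U) q<S+ε)
      where
      instance
        am^j≢0 : NonZero (a * m ^ j)
        am^j≢0 = m*n≢0 a (m ^ j) {{a≢0}} {{m^n≢0 m j}}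
      ε : ℚ
      -- Chosen so that the error scaled by `a * m ^ (k₀ + j)` is exactly `m ^ k₀`, one unit at
      -- position `j`.
      ε = ℤ.+ 1 ℚ./ (a * m ^ j)
      limit : ∃ λ N → ∀ n₀ → N ≤ n₀ → fromℚ (partialSum (digitTerm b) n₀ ℚ.- ε) <ℝ x
                                   × x <ℝ fromℚ (partialSum (digitTerm b) n₀ ℚ.+ ε)
      limit = converges ε (ℚ.positive⁻¹ ε {{ℚ.normalize-pos 1 (a * m ^ j)}})
      k₀ n₀ : ℕ
      k₀ = proj₁ limit
      n₀ = k₀ + j
      close : fromℚ (partialSum (digitTerm b) n₀ ℚ.- ε) <ℝ x × x <ℝ fromℚ (partialSum (digitTerm b) n₀ ℚ.+ ε)
      close = proj₂ limit n₀ (m≤m+n k₀ j)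
      scaled-ε : fromℕ (a * m ^ n₀) ℚ.* ε ≡ fromℕ (m ^ k₀)
      scaled-ε = trans (cong (λ z → fromℕ z ℚ.* ε) (trans (cong (a *_) (^-distribˡ-+-* m k₀ j)) (rearrange a (m ^ k₀) (m ^ j))))
        (fromℕ[c*d]*1/d (m ^ k₀) (a * m ^ j))
        where
        rearrange : ∀ a b c → a * (b * c) ≡ b * (a * c)
        rearrange = solve-∀

    -- After cancelling `m ^ k₀` the error is 1, and `< suc (m ^ j)` is `≤ m ^ j`.
    a*truncation≤m^ : ∀ j → a * truncation j ≤ m ^ j
    a*truncation≤m^ j = s≤s⁻¹ (*-cancelˡ-< (m ^ k₀) (a * truncation j) (suc (m ^ j)) (begin-strict
        m ^ k₀ * (a * truncation j)    ≡⟨ rearrange (m ^ k₀) a (truncation j) ⟩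
        a * (m ^ k₀ * truncation j)    ≤⟨ *-monoʳ-≤ a (truncation-lower j k₀) ⟩
        a * truncation (k₀ + j)        <⟨ lower ⟩
        m ^ (k₀ + j) + m ^ k₀           ≡⟨ cong (_+ m ^ k₀) (^-distribˡ-+-* m k₀ j) ⟩
        m ^ k₀ * m ^ j + m ^ k₀         ≡⟨ +-comm (m ^ k₀ * m ^ j) (m ^ k₀) ⟩
        m ^ k₀ + m ^ k₀ * m ^ j         ≡⟨ *-suc (m ^ k₀) (m ^ j) ⟨
        m ^ k₀ * suc (m ^ j)           ∎))
      where
      open ≤-Reasoning
      k₀ = proj₁ (approximation j)
      lower = proj₁ (proj₂ (approximation j))
      rearrange : ∀ a b c → a * (b * c) ≡ b * (a * c)
      rearrange = solve-∀

    -- Equality means `1 / a = suc (truncation j) / m ^ j`, with all digits from `j` on equal to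
    -- `m ∸ 1`; `tail-digits` rules it out by `Q ∤ u * m ^ i`.
    m^≤a*suc[truncation] : ∀ j → m ^ j ≤ a * suc (truncation j)
    m^≤a*suc[truncation] j = s≤s⁻¹ (*-cancelˡ-< (m ^ k₀) (m ^ j) (suc (a * suc (truncation j))) (begin-strict
        m ^ k₀ * m ^ j                               ≡⟨ ^-distribˡ-+-* m k₀ j ⟨
        m ^ (k₀ + j)                                 <⟨ upper ⟩
        a * truncation (k₀ + j) + m ^ k₀              ≤⟨ +-monoˡ-≤ (m ^ k₀) (*-monoʳ-≤ a (<⇒≤ (truncation-upper j k₀))) ⟩
        a * (m ^ k₀ * suc (truncation j)) + m ^ k₀    ≡⟨ rearrange a (m ^ k₀) (suc (truncation j)) ⟩
        m ^ k₀ * suc (a * suc (truncation j))        ∎))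
      where
      open ≤-Reasoning
      k₀ = proj₁ (approximation j)
      upper = proj₂ (proj₂ (approximation j))
      rearrange : ∀ a b c → a * (b * c) + b ≡ b * suc (a * c)
      rearrange = solve-∀

    -- A Q = a and A u = m ^ J: from position J on, the digits are those of
    -- the purely periodic expansion of (u mod Q) / Q.
    tail-digits : ∀ {A Q u J} .{{_ : NonZero A}} .{{_ : NonZero Q}} → A * Q ≡ a → A * u ≡ m ^ J →
      (∀ i → Q ∤ u * m ^ i) →
      ∀ i → m * (u * m ^ i % Q) ≡ toℕ (b (i + J)) * Q + u * m ^ suc i % Q
    -- Compare `m` times the division of `u * m ^ i` by `Q` with the division of `u * m ^ suc i`;
    -- the quotients are the truncations at `i + J` and `suc i + J`.
    tail-digits {A} {Q} {u} {J} AQ≡a Au≡m^J Q∤ i = +-cancelˡ-≡ (m * T i * Q) _ _ (begin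
      m * T i * Q + m * (u * m ^ i % Q)                      ≡⟨ rearrange₁ m (T i) Q (u * m ^ i % Q) ⟩
      m * (u * m ^ i % Q + T i * Q)                          ≡⟨ cong (m *_) (division i) ⟨
      m * (u * m ^ i)                                        ≡⟨ rearrange₂ m u (m ^ i) ⟩
      u * m ^ suc i                                          ≡⟨ division (suc i) ⟩
      u * m ^ suc i % Q + (m * T i + toℕ (b (i + J))) * Q    ≡⟨ rearrange₃ (u * m ^ suc i % Q) (m * T i) (toℕ (b (i + J))) Q ⟩
      m * T i * Q + (toℕ (b (i + J)) * Q + u * m ^ suc i % Q) ∎)
      where
      open ≡-Reasoning
      T : ℕ → ℕ
      T i = truncation (i + J)
      rearrange₁ : ∀ m t q r → m * t * q + m * r ≡ m * (r + t * q)
      rearrange₁ = solve-∀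
      rearrange₂ : ∀ m u x → m * (u * x) ≡ u * (m * x)
      rearrange₂ = solve-∀
      rearrange₃ : ∀ r t d q → r + (t + d) * q ≡ t * q + (d * q + r)
      rearrange₃ = solve-∀
      m^≡ : ∀ i → m ^ (i + J) ≡ A * (u * m ^ i)
      m^≡ i = trans (^-distribˡ-+-* m i J) (trans (cong (m ^ i *_) (sym Au≡m^J)) (rearrange (m ^ i) A u))
        where
        rearrange : ∀ a b c → a * (b * c) ≡ b * (c * a)
        rearrange = solve-∀
      lower : ∀ i → T i * Q ≤ u * m ^ i
      lower i = subst (_≤ u * m ^ i) (*-comm Q (T i)) (*-cancelˡ-≤ A (subst₂ _≤_
        (trans (cong (_* T i) (sym AQ≡a)) (*-assoc A Q (T i))) (m^≡ i) (a*truncation≤m^ (i + J))))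
      upper : ∀ i → u * m ^ i < suc (T i) * Q
      upper i = ≤∧≢⇒< (subst (u * m ^ i ≤_) (*-comm Q (suc (T i))) (*-cancelˡ-≤ A (subst₂ _≤_
          (m^≡ i) (trans (cong (_* suc (T i)) (sym AQ≡a)) (*-assoc A Q (suc (T i)))) (m^≤a*suc[truncation] (i + J)))))
        (λ eq → Q∤ i (divides (suc (T i)) eq))
      division : ∀ i → u * m ^ i ≡ u * m ^ i % Q + T i * Q
      division i = begin
        u * m ^ i                  ≡⟨ m∸n+n≡m (lower i) ⟨
        r + T i * Q                ≡⟨ cong (_+ T i * Q) (m<n⇒m%n≡m r<Q) ⟨
        r % Q + T i * Q            ≡⟨ cong (_+ T i * Q) ([m+kn]%n≡m%n r (T i) Q) ⟨
        (r + T i * Q) % Q + T i * Q ≡⟨ cong (λ z → z % Q + T i * Q) (m∸n+n≡m (lower i)) ⟩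
        u * m ^ i % Q + T i * Q    ∎
        where
        r = u * m ^ i ∸ T i * Q
        r<Q : r < Q
        r<Q = +-cancelʳ-< (T i * Q) r Q (subst (_< Q + T i * Q) (sym (m∸n+n≡m (lower i))) (upper i))

-- From real logarithms to powers

^-distribʳ-* : ∀ n a b → (a * b) ^ n ≡ a ^ n * b ^ n
^-distribʳ-* zero    a b = refl
^-distribʳ-* (suc n) a b =
  trans (cong (a * b *_) (^-distribʳ-* n a b)) ([m*n]*[o*p]≡[m*o]*[n*p] a b (a ^ n) (b ^ n))

fromℕ-^ : ∀ m n → fromℕ (m ^ n) ≡ fromℕ m ^ℚ n
fromℕ-^ m zero    = refl
fromℕ-^ m (suc n) = trans (fromℕ-* m (m ^ n)) (cong (fromℕ m ℚ.*_) (fromℕ-^ m n))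

≤ℝ⇒≤U : ∀ {n x s} → natℝ n ≤ℝ x → ℝ.U x s → fromℕ n ℚ.≤ s
≤ℝ⇒≤U {x = x} n≤x s∈U = ℚ.≮⇒≥ λ s<n → ℝ.disjoint x (n≤x s<n) s∈U

≤ℝ⇒≤U[x-1] : ∀ n {x s} → natℝ (suc n) ≤ℝ x → ℝ.U (x -ℝ natℝ 1) s → fromℕ n ℚ.≤ s
≤ℝ⇒≤U[x-1] n {x} 1+n≤x (r , r′ , r∈U , -r′<1 , refl) = begin
  fromℕ n                           ≡⟨ ℚ.+-identityʳ (fromℕ n) ⟨
  fromℕ n ℚ.+ 0ℚ                    ≡⟨ cong (fromℕ n ℚ.+_) (ℚ.+-inverseˡ r′) ⟨
  fromℕ n ℚ.+ (ℚ.- r′ ℚ.+ r′)       ≤⟨ ℚ.+-monoʳ-≤ (fromℕ n) (ℚ.+-monoˡ-≤ r′ (ℚ.<⇒≤ -r′<1)) ⟩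
  fromℕ n ℚ.+ (1ℚ ℚ.+ r′)           ≡⟨ ℚ.+-assoc (fromℕ n) 1ℚ r′ ⟨
  fromℕ n ℚ.+ 1ℚ ℚ.+ r′             ≡⟨ cong (ℚ._+ r′) (trans (ℚ.+-comm (fromℕ n) 1ℚ) (sym (fromℕ-suc n))) ⟩
  fromℕ (suc n) ℚ.+ r′              ≤⟨ ℚ.+-monoˡ-≤ r′ (≤ℝ⇒≤U {suc n} {x} 1+n≤x r∈U) ⟩
  r ℚ.+ r′                          ∎
  where open ℚ.≤-Reasoning

module _ (p : ℕ) .{{p>1 : NonTrivial p}} where

  private
    instance
      _ = nonTrivial⇒nonZero p

  -- A rational above `log x` comes with some `s` above `x` whose power is below that of `p`, and
  -- `X ≤ s` passes this on to `X`. Since `X ≥ 1`, the exponent `↥ q` cannot be negative.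
  U-log⇒^< : ∀ {x} (0<x : natℝ 0 <ℝ x) {X} → 1 ≤ X → (∀ {s} → ℝ.U x s → fromℕ X ℚ.≤ s) →
             ∀ {q} → ℝ.U (log p x 0<x) q → ∃ λ k → ↥ q ≡ ℤ.+ k × X ^ ↧ₙ q < p ^ k
  U-log⇒^< 0<x {X} 1≤X X≤ {q} (s , s∈U , s^<) = nonneg (↥ q) X^<
    where
    X^< : fromℕ (X ^ ↧ₙ q) ℚ.< p ^ℤ (↥ q)
    X^< = subst (ℚ._< p ^ℤ (↥ q)) (sym (fromℕ-^ X (↧ₙ q)))
      (ℚ.≤-<-trans (^-mono-≤ (fromℕ-mono-< 1≤X) (X≤ s∈U) (↧ₙ q)) s^<)
    nonneg : ∀ i → fromℕ (X ^ ↧ₙ q) ℚ.< p ^ℤ i → ∃ λ k → i ≡ ℤ.+ k × X ^ ↧ₙ q < p ^ k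
    nonneg (ℤ.+ k)    lt = k , refl , fromℕ-cancel-< (subst (_ ℚ.<_) (sym (fromℕ-^ p k)) lt)
    nonneg -[1+ k ] lt = contradiction (ℚ.<-≤-trans (ℚ.<-≤-trans lt p^-≤1) 1≤X^) (ℚ.<-irrefl refl)
      where
      p^-≤1 : p ^ℤ -[1+ k ] ℚ.≤ 1ℚ
      p^-≤1 = ^ℤ-mono-≤ p {i = -[1+ k ]} {j = ℤ.+ 0} ℤ.-≤+
      1≤X^ : 1ℚ ℚ.≤ fromℕ (X ^ ↧ₙ q)
      1≤X^ = fromℕ-mono-≤ (m^n>0 X {{>-nonZero 1≤X}} (↧ₙ q))

  -- The inequality t + k / d + k′ / d′ < v with denominators cleared.
  exponent-bound : ∀ t v {q q′ k k′} → ↥ q ≡ ℤ.+ k → ↥ q′ ≡ ℤ.+ k′ →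
    fromℕ t ℚ.+ q ℚ.+ q′ ℚ.< fromℕ v →
    t * (↧ₙ q * ↧ₙ q′) + k * ↧ₙ q′ + k′ * ↧ₙ q < v * (↧ₙ q * ↧ₙ q′)
  exponent-bound t v {q@record{}} {q′@record{}} {k} {k′} q≡ q′≡ lt = fromℕ-cancel-< (subst₂ ℚ._<_ lhs rhs
    (ℚ.*-monoʳ-<-pos E {{E>0}} lt))
    where
    d = ↧ₙ q
    d′ = ↧ₙ q′
    E = fromℕ (d * d′)
    E>0 : ℚ.Positive E
    E>0 = ℚ.normalize-pos (d * d′) 1 {{_}} {{m*n≢0 d d′}}
    d*q : ∀ q {k} → ↥ q ≡ ℤ.+ k → fromℕ (↧ₙ q) ℚ.* q ≡ fromℕ k
    d*q q@record{} {k} q≡ = trans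
      (cong (fromℕ (↧ₙ q) ℚ.*_) (trans (sym (ℚ.↥p/↧p≡p q)) (cong (λ i → i ℚ./ ↧ₙ q) q≡))) (fromℕ*/ k (↧ₙ q))
    scale : ∀ c q {k} → ↥ q ≡ ℤ.+ k → fromℕ (c * ↧ₙ q) ℚ.* q ≡ fromℕ (k * c)
    scale c q {k} q≡ = begin
      fromℕ (c * ↧ₙ q) ℚ.* q               ≡⟨ cong (ℚ._* q) (fromℕ-* c (↧ₙ q)) ⟩
      fromℕ c ℚ.* fromℕ (↧ₙ q) ℚ.* q       ≡⟨ ℚ.*-assoc (fromℕ c) (fromℕ (↧ₙ q)) q ⟩
      fromℕ c ℚ.* (fromℕ (↧ₙ q) ℚ.* q)     ≡⟨ cong (fromℕ c ℚ.*_) (d*q q q≡) ⟩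
      fromℕ c ℚ.* fromℕ k                  ≡⟨ fromℕ-* c k ⟨
      fromℕ (c * k)                        ≡⟨ cong fromℕ (*-comm c k) ⟩
      fromℕ (k * c)                        ∎
      where open ≡-Reasoning
    rhs : E ℚ.* fromℕ v ≡ fromℕ (v * (d * d′))
    rhs = trans (sym (fromℕ-* (d * d′) v)) (cong fromℕ (*-comm (d * d′) v))
    lhs : E ℚ.* (fromℕ t ℚ.+ q ℚ.+ q′) ≡ fromℕ (t * (d * d′) + k * d′ + k′ * d)
    lhs = begin
      E ℚ.* (fromℕ t ℚ.+ q ℚ.+ q′)                                  ≡⟨ ℚ.*-distribˡ-+ E (fromℕ t ℚ.+ q) q′ ⟩
      E ℚ.* (fromℕ t ℚ.+ q) ℚ.+ E ℚ.* q′                            ≡⟨ cong (ℚ._+ E ℚ.* q′) (ℚ.*-distribˡ-+ E (fromℕ t) q) ⟩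
      E ℚ.* fromℕ t ℚ.+ E ℚ.* q ℚ.+ E ℚ.* q′                        ≡⟨ cong₂ (λ u w → u ℚ.+ w ℚ.+ E ℚ.* q′)
                                                                          (trans (sym (fromℕ-* (d * d′) t)) (cong fromℕ (*-comm (d * d′) t)))
                                                                          (trans (cong (λ z → fromℕ z ℚ.* q) (*-comm d d′)) (scale d′ q q≡)) ⟩
      fromℕ (t * (d * d′)) ℚ.+ fromℕ (k * d′) ℚ.+ E ℚ.* q′          ≡⟨ cong₂ ℚ._+_ (sym (fromℕ-+ (t * (d * d′)) (k * d′))) (scale d q′ q′≡) ⟩
      fromℕ (t * (d * d′) + k * d′) ℚ.+ fromℕ (k′ * d)              ≡⟨ fromℕ-+ (t * (d * d′) + k * d′) (k′ * d) ⟨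
      fromℕ (t * (d * d′) + k * d′ + k′ * d)                        ∎
      where open ≡-Reasoning

  -- Compare `d * d′`-th powers, where both fractional exponents become integers.
  combine-powers : ∀ {t v X Y k k′} d d′ → X ^ d < p ^ k → Y ^ d′ < p ^ k′ →
    t * (d * d′) + k * d′ + k′ * d < v * (d * d′) → p ^ t * (X * Y) < p ^ v
  combine-powers {t} {v} {X} {Y} {k} {k′} d d′ X^< Y^< exponents =
    ≰⇒> λ p^v≤ → <⇒≱ powers (^-monoˡ-≤ e p^v≤)
    where
    e = d * d′
    open ≤-Reasoning
    powers : (p ^ t * (X * Y)) ^ e < (p ^ v) ^ e
    powers = begin-strict
      (p ^ t * (X * Y)) ^ e                       ≡⟨ ^-distribʳ-* e (p ^ t) (X * Y) ⟩
      (p ^ t) ^ e * (X * Y) ^ e                   ≡⟨ cong₂ _*_ (^-*-assoc p t e) (^-distribʳ-* e X Y) ⟩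
      p ^ (t * e) * (X ^ e * Y ^ e)               ≡⟨ cong₂ (λ u w → p ^ (t * e) * (u * w)) (sym (^-*-assoc X d d′))
                                                       (trans (cong (Y ^_) (*-comm d d′)) (sym (^-*-assoc Y d′ d))) ⟩
      p ^ (t * e) * ((X ^ d) ^ d′ * (Y ^ d′) ^ d) ≤⟨ *-monoʳ-≤ (p ^ (t * e)) (*-mono-≤ (^-monoˡ-≤ d′ (<⇒≤ X^<)) (^-monoˡ-≤ d (<⇒≤ Y^<))) ⟩
      p ^ (t * e) * ((p ^ k) ^ d′ * (p ^ k′) ^ d) ≡⟨ cong₂ (λ u w → p ^ (t * e) * (u * w)) (^-*-assoc p k d′) (^-*-assoc p k′ d) ⟩
      p ^ (t * e) * (p ^ (k * d′) * p ^ (k′ * d)) ≡⟨ *-assoc (p ^ (t * e)) (p ^ (k * d′)) (p ^ (k′ * d)) ⟨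
      p ^ (t * e) * p ^ (k * d′) * p ^ (k′ * d)   ≡⟨ cong (_* p ^ (k′ * d)) (^-distribˡ-+-* p (t * e) (k * d′)) ⟨
      p ^ (t * e + k * d′) * p ^ (k′ * d)         ≡⟨ ^-distribˡ-+-* p (t * e + k * d′) (k′ * d) ⟨
      p ^ (t * e + k * d′ + k′ * d)               <⟨ ^-monoʳ-< p (nonTrivial⇒n>1 p) exponents ⟩
      p ^ (v * e)                                 ≡⟨ ^-*-assoc p v e ⟨
      (p ^ v) ^ e                                 ∎

  exponentiate : ∀ {t v x y X Y} (0<x : natℝ 0 <ℝ x) (0<y : natℝ 0 <ℝ y) → 1 ≤ X → 1 ≤ Y →
    (∀ {s} → ℝ.U x s → fromℕ X ℚ.≤ s) → (∀ {s} → ℝ.U y s → fromℕ Y ℚ.≤ s) →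
    (natℝ t +ℝ log p x 0<x +ℝ log p y 0<y) <ℝ natℝ v →
    p ^ t * (X * Y) < p ^ v
  exponentiate {t} {v} {x} {y} {X} {Y} 0<x 0<y 1≤X 1≤Y X≤x Y≤y
    -- A rational above the sum splits into `t′ + q + q′`, one part above each summand; that it lies
    -- below `v` bounds the exponents.
    (_ , (_ , q′ , (t′ , q , t<t′ , q∈U , refl) , q′∈U , refl) , q+<v) =
    let (k  , q≡  , X^<) = U-log⇒^< {x} 0<x 1≤X X≤x {q} q∈U
        (k′ , q′≡ , Y^<) = U-log⇒^< {y} 0<y 1≤Y Y≤y {q′} q′∈U
    in combine-powers {t} {v} {X} {Y} {k} {k′} (↧ₙ q) (↧ₙ q′) X^< Y^<
         (exponent-bound t v {q} {q′} q≡ q′≡ (ℚ.<-trans (ℚ.+-monoˡ-< q′ (ℚ.+-monoˡ-< q t<t′)) q+<v))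

-- The constant `c` and the exclusion of reciprocals

-- Either argument of the minimum suffices: `∣ D ∣ ≤ m ∸ 1`, and `m ∸ ∣ D ∣ ≤ m ∸ 1` because
-- `∣ D ∣ ≥ 1`.
2#D≤gapConstant : ∀ {m} (D : Subset m) → 1 < ∣ D ∣ → (#D<m : ∣ D ∣ < m) →
                  fromℕ (2 * ∣ D ∣) ℚ.≤ gapConstant m D #D<m
2#D≤gapConstant {m} D 1<#D #D<m = ≤*⊓ W ratio
  (subst (fromℕ (2 * ∣ D ∣) ℚ.≤_) (sym (ℚ.*-identityʳ W)) (fromℕ-mono-≤ (*-monoʳ-≤ 2 (∸-monoˡ-≤ 1 #D<m))))
  (begin
    fromℕ (2 * ∣ D ∣)                         ≡⟨ fromℕ-* 2 ∣ D ∣ ⟩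
    fromℕ 2 ℚ.* fromℕ ∣ D ∣                   ≡⟨ cong (fromℕ 2 ℚ.*_) (fromℕ*/ ∣ D ∣ m-#D) ⟨
    fromℕ 2 ℚ.* (fromℕ m-#D ℚ.* ratio)        ≡⟨ ℚ.*-assoc (fromℕ 2) (fromℕ m-#D) ratio ⟨
    fromℕ 2 ℚ.* fromℕ m-#D ℚ.* ratio          ≡⟨ cong (ℚ._* ratio) (fromℕ-* 2 m-#D) ⟨
    fromℕ (2 * m-#D) ℚ.* ratio                ≤⟨ ℚ.*-monoʳ-≤-nonNeg ratio {{ℚ.normalize-nonNeg ∣ D ∣ m-#D}}
                                                (fromℕ-mono-≤ (*-monoʳ-≤ 2 (∸-monoʳ-≤ m (<⇒≤ 1<#D)))) ⟩
    W ℚ.* ratio                               ∎)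
  where
  open ℚ.≤-Reasoning
  m-#D = m ∸ ∣ D ∣
  instance _ = >-nonZero (m<n⇒0<n∸m #D<m)
  W ratio : ℚ
  W = fromℕ (2 * (m ∸ 1))
  ratio = ℤ.+ ∣ D ∣ ℚ./ m-#D
  ≤*⊓ : ∀ w r {a} → a ℚ.≤ w ℚ.* 1ℚ → a ℚ.≤ w ℚ.* r → a ℚ.≤ w ℚ.* (1ℚ ℚ.⊓ r)
  ≤*⊓ w r {a} a≤w a≤wr with ℚ.⊓-sel 1ℚ r
  ... | inj₁ eq = subst (λ z → a ℚ.≤ w ℚ.* z) (sym eq) a≤w
  ... | inj₂ eq = subst (λ z → a ℚ.≤ w ℚ.* z) (sym eq) a≤wr

-- `1 ≤ κ < p ^ e` forces `e > 0`.
orbit⇒p∣Q : ∀ {p m Q κ} → Orbit p m Q κ → 1 ≤ κ → p ∣ Q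
orbit⇒p∣Q record { e = zero ; κ<p^e = κ<1 } 1≤κ = contradiction κ<1 (≤⇒≯ 1≤κ)
orbit⇒p∣Q {p = p} record { M = M ; e = suc e ; Q≡M*p^e = eq } 1≤κ =
  subst (p ∣_) (sym eq) (∣n⇒∣m*n M (m∣m*n (p ^ e)))

-- With `a = A * Q` and `m ^ j₀ = A * u`, the digits after the first `j₀` are governed by `u / Q`,
-- and `p ∤ u` because `u` divides a power of `m`. The natural number `P` stands in for the real
-- bound `β`.
large-valuation⇒∉K : ∀ {p m} → Prime p → 2 ≤ m → p ∤ m →
  (D : Subset m) → 1 < ∣ D ∣ → ∣ D ∣ < m → ∀ a .{{_ : NonZero a}} →
  let Q = primeToPart m a in ∀ {P} → 2 ≤ P → P⁺ Q ≤ P →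
  p ^ overhead m p * ((P ∸ 1) * (2 * ∣ D ∣)) < p ^ ν p Q →
  ∀ {x} → x ≃ fromℚ (ℤ.+ 1 ℚ./ a) → x ∉ K m D
large-valuation⇒∉K {p} {m} pr 2≤m p∤m D 1<#D #D<m a {P} 2≤P P⁺≤P large {x} x≃1/a (b , b∈D , converges) =
  digits-not-all-in pr p∤m Q D #D<m O p∤u (λ i → b (i + j₀)) (λ i → b∈D (i + j₀))
    (tail-digits b {a} {x} x≃1/a converges {A} {Q} {u} {j₀} (mPart*primeToPart m a) Au≡m^j₀
      (λ i Q∣ → p∤m*n pr p∤u (p∤m^n pr p∤m i) (∣-trans p∣Q Q∣)))
  where
  instance m≢0 = >-nonZero (<⇒≤ 2≤m)
  A = mPart m a
  Q = primeToPart m a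
  j₀ = proj₁ (mPart∣m^ m a)
  A∣m^j₀ = proj₂ (mPart∣m^ m a)
  u = quotient A∣m^j₀
  instance
    A≢0 : NonZero A
    A≢0 = mPart≢0 m a
    Q≢0 : NonZero Q
    Q≢0 = ≢-nonZero λ Q≡0 → ≢-nonZero⁻¹ a (trans (sym (mPart*primeToPart m a)) (trans (cong (A *_) Q≡0) (*-zeroʳ A)))
  Au≡m^j₀ : A * u ≡ m ^ j₀
  Au≡m^j₀ = sym (m∣n⇒n≡m*quotient A∣m^j₀)
  p∤u : p ∤ u
  p∤u p∣u = p∤m^n pr p∤m j₀ (subst (p ∣_) Au≡m^j₀ (∣n⇒∣m*n A p∣u))
  O : Orbit p m Q ∣ D ∣
  O = orbit pr 2≤m p∤m Q 2≤P
    (λ prq q∣Q → (λ q∣m → primeToPart-coprime m a prq q∣m q∣Q) , ≤-trans (p≤P⁺ prq Q q∣Q) P⁺≤P)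
    (<⇒≤ 1<#D) large
  p∣Q : p ∣ Q
  p∣Q = orbit⇒p∣Q {p} {m} O (<⇒≤ 1<#D)

value-nonZero : ∀ a → NonZero (value a)
value-nonZero (mkℕ⁺ (suc _)) = _

corollary3p6 :
  (m : ℕ) (3≤m : 3 ≤ m)
  (D : Subset m) (1<#D : 1 < ∣ D ∣) (#D<m : ∣ D ∣ < m)
  (a : ℕ⁺ → ℕ⁺) →
  let Q = λ (n : ℕ⁺) → primeToPart m (value (a n)) in
  (p₀ : ℕ) (p₀-prime : Prime p₀) (p₀∤m : p₀ ∤ m) →
  let t    = natℝ (overhead m p₀)
      c    = fromℚ (gapConstant m D #D<m)
      logₚ = log p₀ {{prime⇒nonTrivial p₀-prime}}
  in
  (α β : ℕ⁺ → ℝ) (N : ℕ⁺)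
  (α≤ν : ∀ n → N ≤⁺ n → α n ≤ℝ natℝ (ν p₀ (Q n)))
  (P⁺≤β : ∀ n → N ≤⁺ n → natℝ (P⁺ (Q n)) ≤ℝ β n)
  (2≤β : ∀ n → N ≤⁺ n → natℝ 2 ≤ℝ β n)
  (n₀ : ℕ⁺) (N≤n₀ : N ≤⁺ n₀)
  (large : ∀ n (n₀≤n : n₀ ≤⁺ n) →
    (t +ℝ logₚ (β n -ℝ natℝ 1) (2≤x⇒0<x-1 (β n) (2≤β n (≤⁺-trans {N} {n₀} {n} N≤n₀ n₀≤n)))
       +ℝ logₚ c (gapConstant-pos D 1<#D #D<m))
    <ℝ α n) →
  (∀ n → n₀ ≤⁺ n → reciprocal (a n) ∉ K m D)
    × Finite (reciprocals a ∩ K m D)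
corollary3p6 m 3≤m D 1<#D #D<m a p₀ p₀-prime p₀∤m α β N α≤ν P⁺≤β 2≤β n₀ N≤n₀ large =
    (λ n n₀≤n → excluded n n₀≤n {reciprocal (a n)} ((λ l → l) , (λ l → l)))
  -- The indices `suc i` with `i < n₀` include every `n < n₀`; from `n₀` on all terms are excluded.
  , map (λ i → reciprocal (a (mkℕ⁺ (suc i)))) (upTo (value n₀))
  , λ { {x} ((n , x≃1/aₙ) , x∈K) → listed n {x} x≃1/aₙ x∈K }
  where
  -- Stated for every `x ≃ reciprocal (a n)` because membership in `reciprocals` is up to `≃`.
  excluded : ∀ n → n₀ ≤⁺ n → ∀ {x} → x ≃ reciprocal (a n) → x ∉ K m D
  excluded n n₀≤n {x} = large-valuation⇒∉K p₀-prime (≤-trans (n≤1+n 2) 3≤m) p₀∤m D 1<#D #D<m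
    (value (a n)) {{value-nonZero (a n)}} {P} (m≤n⊔m (P⁺ Q) 2) (m≤m⊔n (P⁺ Q) 2)
    (exponentiate p₀ {{prime⇒nonTrivial p₀-prime}} {overhead m p₀} {ν p₀ Q} {β n -ℝ natℝ 1} {fromℚ c}
      {P ∸ 1} {2 * ∣ D ∣}
      (2≤x⇒0<x-1 (β n) (2≤β n N≤n)) (gapConstant-pos D 1<#D #D<m) (m<n⇒0<n∸m (m≤n⊔m (P⁺ Q) 2))
      (≤-trans (<⇒≤ 1<#D) (m≤m+n ∣ D ∣ _))
      (≤ℝ⇒≤U[x-1] (P ∸ 1) {β n} (subst (λ k → natℝ k ≤ℝ β n) (sym (m+[n∸m]≡n (≤-trans (s≤s z≤n) (m≤n⊔m (P⁺ Q) 2)))) P≤β))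
      (λ c<s → ℚ.≤-trans (2#D≤gapConstant D 1<#D #D<m) (ℚ.<⇒≤ c<s))
      (let (q , q∈U , q∈L) = large n n₀≤n in q , q∈U , α≤ν n N≤n q∈L)) {x}
    where
    Q = primeToPart m (value (a n))
    c = gapConstant m D #D<m
    -- Raising `P⁺ Q` to at least 2 keeps `P ∸ 1` positive even when `Q = 1`; `P ≤ β n` still holds
    -- by `2≤β`.
    P = P⁺ Q ⊔ 2
    N≤n = ≤⁺-trans {N} {n₀} {n} N≤n₀ n₀≤n
    P≤β : natℝ P ≤ℝ β n
    P≤β = [ (λ eq → subst (λ k → natℝ k ≤ℝ β n) (sym eq) (P⁺≤β n N≤n))
          , (λ eq → subst (λ k → natℝ k ≤ℝ β n) (sym eq) (2≤β n N≤n)) ]′ (⊔-sel (P⁺ Q) 2)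
  listed : ∀ n {x} → x ≃ reciprocal (a n) → K m D x →
           Any (x ≃_) (map (λ i → reciprocal (a (mkℕ⁺ (suc i)))) (upTo (value n₀)))
  listed n@(mkℕ⁺ (suc i)) {x} x≃1/aₙ x∈K =
    [ (λ n₀≤n → contradiction x∈K (excluded n n₀≤n {x} x≃1/aₙ))
    , (λ n<n₀ → Any.map⁺ (lose (∈-upTo⁺ (<-trans (n<1+n i) n<n₀)) x≃1/aₙ))
    ]′ (≤-<-connex (value n₀) (suc i))
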